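{- For all $n \ge 1$, let $\mathcal H_{2n-1}=\{x_i-x_j=y_i:1\le i<j\le n+1\}$ be the arrangement in $\mathbb R^{2n+2}$ and let $\hat 0,\hat 1$ be the minimum and maximum of its intersection lattice. Then $$\mu_{\mathcal L(\mathcal H_{2n-1})}(\hat{0},\hat{1}) = -|\mathcal{DC}_{2n}| = -g_{n}.$$
   Context: $\mathcal L(\mathcal A)$ is the intersection lattice of an arrangement (nonempty intersections of hyperplanes ordered by reverse inclusion), and $\mu$ its Möbius function. A D-permutation of $[2n]$ is a permutation $\sigma$ with $i\le\sigma(i)$ for odd $i$ and $i\ge\sigma(i)$ for even $i$; $\mathcal{DC}_{2n}$ is the set of D-permutations of $[2n]$ consisting of a single cycle. A Dumont permutation is a $\sigma\in\mathfrak S_{2N}$ with $2i>\sigma(2i)$ and $2i-1\le\sigma(2i-1)$ for all $i=1,\dots,N$. For $n\ge1$, the Genocchi number $g_n$ is the number of Dumont permutations in $\mathfrak S_{2n-2}$ (with $g_1=1$).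
   Formalization: The arrangement is taken in rational space of dimension 2n+2 rather than in real space; its hyperplanes have integer coefficients, so the intersection lattice is the same. -}

module Defs where

open import Data.Bool using (Bool)
open import Data.Nat as ℕ using (ℕ; zero; suc; _≤_; _<_; _%_; _*_; _∸_)
open import Data.Fin as Fin using (Fin; toℕ)
open import Data.Fin.Properties using () renaming (_≟_ to _≟ᶠ_; all? to allᶠ?; any? to anyᶠ?)
open import Data.Integer as ℤ using (ℤ; +_; -_)
open import Data.Rational as ℚ using (ℚ)
open import Data.List using (List; []; _∷_; foldr; _++_; map; filter; concatMap; length)
open import Data.List.Properties using () renaming (≡-dec to List-≡-dec)
open import Data.List.Relation.Unary.All as All using (All)
open import Data.List.Membership.Propositional using (_∈_)
open import Data.List.Membership.DecPropositional using () renaming (_∈?_ to mem?)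
open import Data.Product using (Σ; ∃; _×_; _,_; proj₁; proj₂)
open import Data.Product.Properties using () renaming (≡-dec to ×-≡-dec)
open import Data.Vec using (Vec; lookup)
import Data.Vec as Vec
open import Function using (_∘_)
open import Relation.Nullary using (Dec; yes; no; ¬?)
open import Relation.Nullary.Decidable using (_×-dec_; _→-dec_; map′)
open import Relation.Unary using (Decidable)
open import Relation.Binary using (DecidableEquality)
open import Relation.Binary.PropositionalEquality using (_≡_)

-- Möbius function of a finite poset.
-- The poset is given by a list `els` of its elements (each exactly once),
-- a decidable equality and a decidable order relation.  The defining
-- recursion  μ(x,x) = 1,  μ(x,y) = - Σ_{x ≤ z < y} μ(x,z)  (x < y),
-- μ(x,y) = 0 otherwise, is run with fuel; fuel  1 + |els|  exceeds the
-- length of every chain, so the result is the Möbius function.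

module _ {A : Set} {_≤ᵖ_ : A → A → Set}
         (els : List A) (_≟ᵖ_ : DecidableEquality A)
         (_≤?ᵖ_ : (x y : A) → Dec (x ≤ᵖ y)) where

  private
    sumℤ : List ℤ → ℤ
    sumℤ = foldr ℤ._+_ (+ 0)

    μ-fuel : ℕ → A → A → ℤ
    μ-fuel zero x y = + 0
    μ-fuel (suc f) x y with x ≟ᵖ y
    ... | yes _ = + 1
    ... | no _ with x ≤?ᵖ y
    ...   | no _ = + 0
    ...   | yes _ =
      - sumℤ (map (μ-fuel f x)
                 (filter (λ z → (x ≤?ᵖ z) ×-dec ((z ≤?ᵖ y) ×-dec ¬? (z ≟ᵖ y))) els))

  möbius : A → A → ℤ
  möbius = μ-fuel (suc (length els))

-- The arrangement H_{2n-1} = { x_i - x_j = y_i : 1 ≤ i < j ≤ n+1 }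
-- in (n+1) + (n+1) = 2n+2 coordinates, written with k = n+1 and
-- 0-based indices.  Coordinates taken over ℚ.

Point : ℕ → Set
Point k = (Fin k → ℚ) × (Fin k → ℚ)

Hyp : ℕ → Set
Hyp k = Fin k × Fin k

hyps : (k : ℕ) → List (Hyp k)
hyps k = filter (λ p → proj₁ p Fin.<? proj₂ p)
                (concatMap (λ i → map (i ,_) (Data.List.allFin k)) (Data.List.allFin k))
  where import Data.List

OnHyp : ∀ {k} → Hyp k → Point k → Set
OnHyp (i , j) (x , y) = x i ℚ.- x j ≡ y i

InInter : ∀ {k} → List (Hyp k) → Point k → Set
InInter S p = All (λ H → OnHyp H p) S

InterSub : ∀ {k} → List (Hyp k) → Hyp k → Set
InterSub S H = ∀ p → InInter S p → OnHyp H p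

-- ∩T ⊆ ∩S , i.e.  ∩S ≤ ∩T  in the intersection lattice (reverse inclusion)
_≤L_ : ∀ {k} → List (Hyp k) → List (Hyp k) → Set
S ≤L T = ∀ p → InInter T p → InInter S p

-- A flat X is represented by the (sub)list of hyperplanes containing it
-- (in the fixed order of `hyps k`); such an S is exactly a list with
-- every hyperplane containing ∩S already in S.
Closed : ∀ {k} → List (Hyp k) → Set
Closed {k} S = All (λ H → InterSub S H → H ∈ S) (hyps k)

sublists : ∀ {A : Set} → List A → List (List A)
sublists [] = [] ∷ []
sublists (a ∷ as) = sublists as ++ map (a ∷_) (sublists as)

-- A decision procedure for ∩S ⊆ H (exists by linear algebra; the
-- theorem quantifies over all of them; the Möbius value does not depend
-- on the choice since Dec of a proposition has a determined yes/no).
InterSubDec : ℕ → Set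
InterSubDec k = (S : List (Hyp k)) (H : Hyp k) → Dec (InterSub S H)

module _ {k : ℕ} (dec : InterSubDec k) where

  closed? : (S : List (Hyp k)) → Dec (Closed S)
  closed? S = All.all? (λ H → dec S H →-dec mem? (×-≡-dec _≟ᶠ_ _≟ᶠ_) H S) (hyps k)

  ≤L? : (S T : List (Hyp k)) → Dec (S ≤L T)
  ≤L? S T = map′ to from (All.all? (dec T) S)
    where
      to : All (InterSub T) S → S ≤L T
      to a p pT = All.map (λ sub → sub p pT) a
      from : S ≤L T → All (InterSub T) S
      from le = All.tabulate (λ H∈S p pT → All.lookup (le p pT) H∈S)

  flats : List (List (Hyp k))
  flats = filter closed? (sublists (hyps k))

-- μ_{L(H_{2n-1})}(0̂, 1̂);  0̂ = ambient space = ∩[] ,  1̂ = ∩(all hyperplanes)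
μH : (n : ℕ) → InterSubDec (suc n) → ℤ
μH n dec = möbius (flats dec) (List-≡-dec (×-≡-dec _≟ᶠ_ _≟ᶠ_)) (≤L? dec) [] (hyps (suc n))

allVecs : (m l : ℕ) → List (Vec (Fin m) l)
allVecs m zero = Vec.[] ∷ []
allVecs m (suc l) = concatMap (λ a → map (a Vec.∷_) (allVecs m l)) (Data.List.allFin m)
  where import Data.List

IsPerm : ∀ {m} → Vec (Fin m) m → Set
IsPerm σ = ∀ i j → lookup σ i ≡ lookup σ j → i ≡ j

isPerm? : ∀ {m} (σ : Vec (Fin m) m) → Dec (IsPerm σ)
isPerm? σ = allᶠ? λ i → allᶠ? λ j → (lookup σ i ≟ᶠ lookup σ j) →-dec (i ≟ᶠ j)

pos : ∀ {m} → Fin m → ℕ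
pos i = suc (toℕ i)

IsD : ∀ {m} → Vec (Fin m) m → Set
IsD σ = ∀ i → (pos i % 2 ≡ 1 → pos i ≤ pos (lookup σ i))
            × (pos i % 2 ≡ 0 → pos (lookup σ i) ≤ pos i)

isD? : ∀ {m} (σ : Vec (Fin m) m) → Dec (IsD σ)
isD? σ = allᶠ? λ i → ((pos i % 2 ℕ.≟ 1) →-dec (pos i ℕ.≤? pos (lookup σ i)))
                 ×-dec ((pos i % 2 ℕ.≟ 0) →-dec (pos (lookup σ i) ℕ.≤? pos i))

iter : ∀ {m} → Vec (Fin m) m → ℕ → Fin m → Fin m
iter σ zero i = i
iter σ (suc t) i = lookup σ (iter σ t i)

-- σ consists of a single cycle: every j is in the σ-orbit of every i
-- (orbits have size ≤ m, so exponents t < m suffice)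
SingleCycle : ∀ {m} → Vec (Fin m) m → Set
SingleCycle {m} σ = ∀ i j → ∃ λ (t : Fin m) → iter σ (toℕ t) i ≡ j

singleCycle? : ∀ {m} (σ : Vec (Fin m) m) → Dec (SingleCycle σ)
singleCycle? σ = allᶠ? λ i → allᶠ? λ j → anyᶠ? λ t → iter σ (toℕ t) i ≟ᶠ j

numDC : ℕ → ℕ
numDC n = length (filter (λ σ → isPerm? σ ×-dec (isD? σ ×-dec singleCycle? σ))
                         (allVecs (2 * n) (2 * n)))

IsDumont : ∀ {m} → Vec (Fin m) m → Set
IsDumont σ = ∀ i → (pos i % 2 ≡ 1 → pos i ≤ pos (lookup σ i))
                 × (pos i % 2 ≡ 0 → pos (lookup σ i) < pos i)

isDumont? : ∀ {m} (σ : Vec (Fin m) m) → Dec (IsDumont σ)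
isDumont? σ = allᶠ? λ i → ((pos i % 2 ℕ.≟ 1) →-dec (pos i ℕ.≤? pos (lookup σ i)))
                     ×-dec ((pos i % 2 ℕ.≟ 0) →-dec (pos (lookup σ i) ℕ.<? pos i))

genocchi : ℕ → ℕ
genocchi n = length (filter (λ σ → isPerm? σ ×-dec isDumont? σ)
                            (allVecs (2 * (n ∸ 1)) (2 * (n ∸ 1))))

-- All three numbers are computed by the Gandhi recursion g₀(x) = x, gₘ₊₁(x) = x² (gₘ(x+1) - gₘ(x)),
-- up to sign they are gₙ₋₁(1).
--
-- Putting u_i = x_i - y_i turns the hyperplanes into the equations u_i = x_j (i < j), the edges of
-- a bipartite graph.  By Whitney's formula μ(0̂,1̂) is the sum of (-1)^|S| over the spanning connected
-- edge sets S.  Adding the u_i in the order of decreasing i, only the number b of components matters: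
-- a vertex x_j joins, and u_i merges a nonempty set of components.  On the functions b ↦ (-x)^(b+1)
-- this linear operator is x² times the difference in x.
--
-- For Dumont permutations, and likewise for cyclic D-permutations, the condition σ(p) ≥ p in the odd
-- rows is written as 1 - [σ(p) < p].  The rows with the constant weight 1 can be filled last; the
-- remaining ones, taken in increasing order, have r choices each, where r is the number of rows
-- postponed so far.  The r postponed rows can be filled in r! ways, or in (r-1)! ways if a single
-- cycle is to arise.
{-# OPTIONS --safe #-}
module Submission where

open import Defs
open import Data.Bool using (if_then_else_)
open import Data.Nat as ℕ using (ℕ; zero; suc; z≤n; s≤s; _≤_; _<_; _%_; _∸_)
import Data.Nat.Properties as ℕ
open import Data.Fin as Fin using (Fin; zero; suc; toℕ)
import Data.Fin.Properties as Fin
open import Data.Integer as ℤ using (ℤ; +_; -_; _+_; _*_; _-_)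
import Data.Integer.Properties as ℤ
open import Data.Integer.Tactic.RingSolver using (solve-∀)
open import Data.Rational as ℚ using (ℚ; 0ℚ; 1ℚ)
import Data.Rational.Properties as ℚ
open import Data.List using (List; []; _∷_; _++_; foldr; map; filter; concatMap; cartesianProduct; length; allFin; tabulate; replicate)
open import Data.List.Properties using (length-filter; filter-none; filter-++; filter-all; concatMap-cong)
import Data.List.Properties as List
open import Data.List.Membership.Propositional using (_∈_)
open import Data.List.Membership.Propositional.Properties using (∈-filter⁻; ∈-filter⁺; ∈-map⁺; ∈-map⁻; ∈-∃++; ∈-++⁺ˡ; ∈-++⁺ʳ; ∈-++⁻; ∈-allFin; ∈-cartesianProduct⁺)
open import Data.List.Membership.DecPropositional using () renaming (_∈?_ to mem?)
open import Data.List.Relation.Unary.Any using (here; there)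
open import Data.List.Relation.Unary.All as All using (All; []; _∷_)
open import Data.List.Relation.Unary.AllPairs using ([]; _∷_)
open import Data.List.Relation.Unary.Unique.Propositional using (Unique)
import Data.List.Relation.Unary.Unique.Propositional.Properties as Unique
open import Data.List.Relation.Binary.Subset.Propositional using (_⊆_)
open import Data.List.Relation.Binary.Permutation.Propositional as ↭ using (_↭_; prep; swap)
open import Data.List.Relation.Binary.Permutation.Propositional.Properties using (↭-length; shift; filter-↭; ∈-resp-↭)
open import Relation.Binary.Construct.Closure.Transitive using (TransClosure; [_]; _∷_) renaming (_++_ to _⁺++_)
open import Data.List.Relation.Binary.Permutation.Setoid.Properties using (Unique-resp-↭)
open import Data.Vec as Vec using (Vec; []; _∷_; lookup)
import Data.Vec.Properties as Vec
open import Data.Product using (Σ; ∃; _×_; _,_; proj₁; proj₂)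
open import Data.Product.Properties using () renaming (≡-dec to ×-≡-dec)
open import Data.Sum using (_⊎_; inj₁; inj₂)
open import Data.Empty using (⊥)
open import Function using (_∘_; id; case_of_)
open import Relation.Nullary using (Dec; yes; no; does; ¬?; ¬_)
open import Relation.Nullary.Decidable using (_×-dec_; _→-dec_; map′)
open import Relation.Nullary.Negation using (contradiction)
open import Relation.Unary using (Decidable)
open import Relation.Binary using (DecidableEquality)
open import Relation.Binary.PropositionalEquality
open ≡-Reasoning

-- When u_i is added in decreasing order of i, every x_j present at that moment is a neighbour of
-- u_i. Any set of components can therefore be hit, which is why only their number enters. All edges
-- at u_i belong to one row, so a u_i left isolated stays isolated and makes the whole term vanish.
-- The power (-x)^(b+1) comes from the binomial theorem: with y = -x the alternating sum over the
-- merged components produces (y-1)^(b+1), that is, x moves to x+1.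
--
-- In the permutation counts the increasing order ensures that all columns used so far lie below the
-- bound of the current row, so the number of choices does not depend on the earlier ones. For
-- single cycles it is not enough to know which columns are used, because a cycle must not close too
-- early. Partial cycles are kept as paths, of which only the first element and the row of the last
-- element matter. The base values r! and (r-1)! differ by exactly one Gandhi step; this makes up
-- for the two rows by which Dumont permutations of [2n-2] fall short of D-permutations of [2n].

private variable
  A B : Set
  P Q : Set

-- Finite sums and indicators

+-congˡ : ∀ a {b c} → b ≡ c → a + b ≡ a + c
+-congˡ a = cong (λ b → a + b)

∑ : List A → (A → ℤ) → ℤ
∑ [] f = + 0
∑ (x ∷ xs) f = f x + ∑ xs f

foldr-map-∑ : ∀ (xs : List A) f → foldr _+_ (+ 0) (map f xs) ≡ ∑ xs f
foldr-map-∑ [] f = refl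
foldr-map-∑ (x ∷ xs) f = cong (λ s → f x + s) (foldr-map-∑ xs f)

∑-cong∈ : ∀ (xs : List A) {f g : A → ℤ} → (∀ {x} → x ∈ xs → f x ≡ g x) → ∑ xs f ≡ ∑ xs g
∑-cong∈ [] eq = refl
∑-cong∈ (x ∷ xs) eq = cong₂ _+_ (eq (here refl)) (∑-cong∈ xs (eq ∘ there))

∑-cong : ∀ (xs : List A) {f g : A → ℤ} → (∀ x → f x ≡ g x) → ∑ xs f ≡ ∑ xs g
∑-cong xs eq = ∑-cong∈ xs (λ {x} _ → eq x)

∑-++ : ∀ (xs ys : List A) f → ∑ (xs ++ ys) f ≡ ∑ xs f + ∑ ys f
∑-++ [] ys f = sym (ℤ.+-identityˡ _)
∑-++ (x ∷ xs) ys f = trans (+-congˡ (f x) (∑-++ xs ys f)) (sym (ℤ.+-assoc (f x) _ _))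

∑-map : ∀ (h : A → B) xs f → ∑ (map h xs) f ≡ ∑ xs (f ∘ h)
∑-map h [] f = refl
∑-map h (x ∷ xs) f = +-congˡ (f (h x)) (∑-map h xs f)

∑-concatMap : ∀ (h : A → List B) xs f → ∑ (concatMap h xs) f ≡ ∑ xs (λ x → ∑ (h x) f)
∑-concatMap h [] f = refl
∑-concatMap h (x ∷ xs) f =
  trans (∑-++ (h x) (concatMap h xs) f) (+-congˡ (∑ (h x) f) (∑-concatMap h xs f))

∑-+ : ∀ (xs : List A) f g → ∑ xs (λ x → f x + g x) ≡ ∑ xs f + ∑ xs g
∑-+ [] f g = refl
∑-+ (x ∷ xs) f g rewrite ∑-+ xs f g = lemma (f x) (g x) (∑ xs f) (∑ xs g)
  where
    lemma : ∀ a b c d → (a + b) + (c + d) ≡ (a + c) + (b + d)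
    lemma = solve-∀

∑-*ˡ : ∀ c (xs : List A) f → ∑ xs (λ x → c * f x) ≡ c * ∑ xs f
∑-*ˡ c [] f = sym (ℤ.*-zeroʳ c)
∑-*ˡ c (x ∷ xs) f rewrite ∑-*ˡ c xs f = sym (ℤ.*-distribˡ-+ c (f x) _)

∑-*ʳ : ∀ c (xs : List A) f → ∑ xs (λ x → f x * c) ≡ ∑ xs f * c
∑-*ʳ c xs f = begin
  ∑ xs (λ x → f x * c) ≡⟨ ∑-cong xs (λ x → ℤ.*-comm (f x) c) ⟩
  ∑ xs (λ x → c * f x) ≡⟨ ∑-*ˡ c xs f ⟩
  c * ∑ xs f           ≡⟨ ℤ.*-comm c _ ⟩
  ∑ xs f * c           ∎

∑-zero : ∀ (xs : List A) → ∑ xs (λ _ → + 0) ≡ + 0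
∑-zero [] = refl
∑-zero (x ∷ xs) = trans (ℤ.+-identityˡ _) (∑-zero xs)

∑-- : ∀ (xs : List A) f g → ∑ xs (λ x → f x - g x) ≡ ∑ xs f - ∑ xs g
∑-- [] f g = refl
∑-- (x ∷ xs) f g rewrite ∑-- xs f g = lemma (f x) (g x) (∑ xs f) (∑ xs g)
  where
    lemma : ∀ a b c d → (a - b) + (c - d) ≡ (a + c) - (b + d)
    lemma = solve-∀

∑-swap : ∀ (xs : List A) (ys : List B) (f : A → B → ℤ) →
  ∑ xs (λ x → ∑ ys (f x)) ≡ ∑ ys (λ y → ∑ xs (λ x → f x y))
∑-swap [] ys f = sym (∑-zero ys)
∑-swap (x ∷ xs) ys f rewrite ∑-swap xs ys f = sym (∑-+ ys (f x) _)

⟦_⟧ : Dec P → ℤ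
⟦ yes _ ⟧ = + 1
⟦ no _ ⟧ = + 0

-- The two decisions are unrelated. This lets the arbitrary `dec` of the theorem be traded for tests
-- on lists and block numbers without ever being inspected.
⟦⟧-cong : (P → Q) → (Q → P) → (p : Dec P) (q : Dec Q) → ⟦ p ⟧ ≡ ⟦ q ⟧
⟦⟧-cong f g (yes p) (yes q) = refl
⟦⟧-cong f g (yes p) (no ¬q) = contradiction (f p) ¬q
⟦⟧-cong f g (no ¬p) (yes q) = contradiction (g q) ¬p
⟦⟧-cong f g (no ¬p) (no ¬q) = refl

⟦⟧-yes : P → (p : Dec P) → ⟦ p ⟧ ≡ + 1
⟦⟧-yes x (yes _) = refl
⟦⟧-yes x (no ¬x) = contradiction x ¬x

⟦⟧-no : ¬ P → (p : Dec P) → ⟦ p ⟧ ≡ + 0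
⟦⟧-no ¬x (yes x) = contradiction x ¬x
⟦⟧-no ¬x (no _) = refl

⟦⟧-× : (p : Dec P) (q : Dec Q) → ⟦ p ×-dec q ⟧ ≡ ⟦ p ⟧ * ⟦ q ⟧
⟦⟧-× (yes _) (yes _) = refl
⟦⟧-× (yes _) (no _) = refl
⟦⟧-× (no _) (yes _) = refl
⟦⟧-× (no _) (no _) = refl

⟦⟧-¬ : (p : Dec P) → ⟦ ¬? p ⟧ ≡ + 1 - ⟦ p ⟧
⟦⟧-¬ (yes _) = refl
⟦⟧-¬ (no _) = refl

∑-filter : ∀ {R : A → Set} (R? : Decidable R) xs f → ∑ (filter R? xs) f ≡ ∑ xs (λ x → ⟦ R? x ⟧ * f x)
∑-filter R? [] f = refl
∑-filter R? (x ∷ xs) f with R? x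
... | yes _ = cong₂ _+_ (sym (ℤ.*-identityˡ (f x))) (∑-filter R? xs f)
... | no _ = trans (∑-filter R? xs f) (sym (ℤ.+-identityˡ _))

length-filter-∑ : ∀ {R : A → Set} (R? : Decidable R) xs → + length (filter R? xs) ≡ ∑ xs (λ x → ⟦ R? x ⟧)
length-filter-∑ R? [] = refl
length-filter-∑ R? (x ∷ xs) with R? x
... | yes _ = +-congˡ (+ 1) (length-filter-∑ R? xs)
... | no _ = trans (length-filter-∑ R? xs) (sym (ℤ.+-identityˡ _))

∑-pick : ∀ (_≟_ : DecidableEquality A) {xs} → Unique xs → ∀ {a} → a ∈ xs → ∀ (f : A → ℤ) →
  ∑ xs (λ x → ⟦ x ≟ a ⟧ * f x) ≡ f a
∑-pick _≟_ {x ∷ xs} (x∉ ∷ u) {a} a∈ f with x ≟ a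
... | yes refl = begin
  + 1 * f x + ∑ xs (λ y → ⟦ y ≟ x ⟧ * f y)
    ≡⟨ cong₂ _+_ (ℤ.*-identityˡ (f x))
         (trans (∑-cong∈ xs (λ {y} y∈ → cong (_* f y) (⟦⟧-no (All.lookup x∉ y∈ ∘ sym) (y ≟ x)))) (∑-zero xs)) ⟩
  f x + + 0 ≡⟨ ℤ.+-identityʳ _ ⟩
  f x ∎
∑-pick _≟_ {x ∷ xs} (x∉ ∷ u) {a} (here a≡x) f | no x≢a = contradiction (sym a≡x) x≢a
∑-pick _≟_ {x ∷ xs} (x∉ ∷ u) {a} (there a∈) f | no x≢a = trans (ℤ.+-identityˡ _) (∑-pick _≟_ u a∈ f)

length-filter-≤ : ∀ {R S : A → Set} (R? : Decidable R) (S? : Decidable S) xs →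
  (∀ {x} → x ∈ xs → R x → S x) → length (filter R? xs) ℕ.≤ length (filter S? xs)
length-filter-≤ R? S? [] R⊆S = z≤n
length-filter-≤ R? S? (x ∷ xs) R⊆S with R? x | S? x
... | yes r | yes _ = s≤s (length-filter-≤ R? S? xs (R⊆S ∘ there))
... | yes r | no ¬s = contradiction (R⊆S (here refl) r) ¬s
... | no _ | yes _ = ℕ.m≤n⇒m≤1+n (length-filter-≤ R? S? xs (R⊆S ∘ there))
... | no _ | no _ = length-filter-≤ R? S? xs (R⊆S ∘ there)

length-filter-< : ∀ {R S : A → Set} (R? : Decidable R) (S? : Decidable S) xs →
  (∀ {x} → x ∈ xs → R x → S x) → ∀ {w} → w ∈ xs → S w → ¬ R w →
  length (filter R? xs) ℕ.< length (filter S? xs)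
length-filter-< R? S? (x ∷ xs) R⊆S (here refl) s ¬r with R? x | S? x
... | yes r | _ = contradiction r ¬r
... | no _ | yes _ = s≤s (length-filter-≤ R? S? xs (R⊆S ∘ there))
... | no _ | no ¬s = contradiction s ¬s
length-filter-< R? S? (x ∷ xs) R⊆S (there w∈) s ¬r with R? x | S? x
... | yes r | yes _ = s≤s (length-filter-< R? S? xs (R⊆S ∘ there) w∈ s ¬r)
... | yes r | no ¬s = contradiction (R⊆S (here refl) r) ¬s
... | no _ | yes _ = ℕ.m≤n⇒m≤1+n (length-filter-< R? S? xs (R⊆S ∘ there) w∈ s ¬r)
... | no _ | no _ = length-filter-< R? S? xs (R⊆S ∘ there) w∈ s ¬r

-- Alternating sums over sublists

-- The sum of (-1)^|S| g S over the sublists S of a list.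
alt : List A → (List A → ℤ) → ℤ
alt [] g = g []
alt (x ∷ xs) g = alt xs g - alt xs (g ∘ (x ∷_))

alt-cong⊆ : ∀ (xs : List A) {g h : List A → ℤ} → (∀ S → S ⊆ xs → g S ≡ h S) → alt xs g ≡ alt xs h
alt-cong⊆ [] eq = eq [] id
alt-cong⊆ (x ∷ xs) eq = cong₂ _-_ (alt-cong⊆ xs (λ S S⊆ → eq S (there ∘ S⊆)))
  (alt-cong⊆ xs (λ S S⊆ → eq (x ∷ S) (λ { (here p) → here p ; (there p) → there (S⊆ p) })))

alt-cong : ∀ (xs : List A) {g h : List A → ℤ} → (∀ S → g S ≡ h S) → alt xs g ≡ alt xs h
alt-cong xs eq = alt-cong⊆ xs (λ S _ → eq S)

alt-zero : ∀ (xs : List A) → alt xs (λ _ → + 0) ≡ + 0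
alt-zero [] = refl
alt-zero (x ∷ xs) rewrite alt-zero xs = refl

alt-+ : ∀ (xs : List A) g h → alt xs (λ S → g S + h S) ≡ alt xs g + alt xs h
alt-+ [] g h = refl
alt-+ (x ∷ xs) g h
  rewrite alt-+ xs g h | alt-+ xs (g ∘ (x ∷_)) (h ∘ (x ∷_)) = lemma (alt xs g) _ _ _
  where
    lemma : ∀ a b c d → (a + b) - (c + d) ≡ (a - c) + (b - d)
    lemma = solve-∀

alt-*ˡ : ∀ c (xs : List A) g → alt xs (λ S → c * g S) ≡ c * alt xs g
alt-*ˡ c [] g = refl
alt-*ˡ c (x ∷ xs) g
  rewrite alt-*ˡ c xs g | alt-*ˡ c xs (g ∘ (x ∷_)) = lemma c (alt xs g) _
  where
    lemma : ∀ a b c → a * b - a * c ≡ a * (b - c)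
    lemma = solve-∀

alt-- : ∀ (xs : List A) g h → alt xs (λ S → g S - h S) ≡ alt xs g - alt xs h
alt-- [] g h = refl
alt-- (x ∷ xs) g h
  rewrite alt-- xs g h | alt-- xs (g ∘ (x ∷_)) (h ∘ (x ∷_)) = lemma (alt xs g) _ _ _
  where
    lemma : ∀ a b c d → (a - b) - (c - d) ≡ (a - c) - (b - d)
    lemma = solve-∀

alt-∑ : ∀ (xs : List A) (zs : List B) (g : B → List A → ℤ) →
  alt xs (λ S → ∑ zs (λ z → g z S)) ≡ ∑ zs (λ z → alt xs (g z))
alt-∑ xs [] g = alt-zero xs
alt-∑ xs (z ∷ zs) g = trans (alt-+ xs (g z) _) (+-congˡ (alt xs (g z)) (alt-∑ xs zs g))

-- The second list is summed outside: the rows of larger index then form a fixed graph to which the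
-- current row is added.
alt-++ : ∀ (xs ys : List A) g → alt (xs ++ ys) g ≡ alt ys (λ T → alt xs (λ S → g (S ++ T)))
alt-++ [] ys g = refl
alt-++ (x ∷ xs) ys g = begin
  alt (xs ++ ys) g - alt (xs ++ ys) (g ∘ (x ∷_))
    ≡⟨ cong₂ _-_ (alt-++ xs ys g) (alt-++ xs ys (g ∘ (x ∷_))) ⟩
  alt ys (λ T → alt xs (λ S → g (S ++ T))) - alt ys (λ T → alt xs (λ S → g (x ∷ S ++ T)))
    ≡⟨ alt-- ys _ _ ⟨
  alt ys (λ T → alt (x ∷ xs) (λ S → g (S ++ T))) ∎

-- Uniqueness of the Möbius function

module _ {_≤ᵖ_ : A → A → Set} (els : List A) (_≟ᵖ_ : DecidableEquality A)
         (_≤?ᵖ_ : (x y : A) → Dec (x ≤ᵖ y)) where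

  private
    below : A → A → List A
    below x y = filter (λ z → (x ≤?ᵖ z) ×-dec ((z ≤?ᵖ y) ×-dec ¬? (z ≟ᵖ y))) els

  -- The fuelled recursion behind möbius is private to Defs; the metavariable
  -- is solved by that recursion when möbius-step is checked.
  mutual
    boundedMöbius : ℕ → A → A → ℤ
    boundedMöbius = _

    möbius-step : ∀ x y → ¬ x ≡ y → x ≤ᵖ y →
      möbius els _≟ᵖ_ _≤?ᵖ_ x y ≡ - foldr _+_ (+ 0) (map (boundedMöbius (length els) x) (below x y))
    möbius-step x y x≢y x≤y with x ≟ᵖ y
    ... | yes p = contradiction p x≢y
    ... | no _ with x ≤?ᵖ y
    ...   | no q = contradiction x≤y q
    ...   | yes _ with length els
    ...     | n = refl

  private
    bounded-refl : ∀ f x → boundedMöbius (suc f) x x ≡ + 1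
    bounded-refl f x with x ≟ᵖ x
    ... | yes _ = refl
    ... | no q = contradiction refl q

    bounded-step : ∀ f x y → ¬ x ≡ y → x ≤ᵖ y →
      boundedMöbius (suc f) x y ≡ - ∑ (below x y) (boundedMöbius f x)
    bounded-step f x y x≢y x≤y with x ≟ᵖ y
    ... | yes p = contradiction p x≢y
    ... | no _ with x ≤?ᵖ y
    ...   | no q = contradiction x≤y q
    ...   | yes _ = cong -_ (foldr-map-∑ (below x y) (boundedMöbius f x))

  module _ (≤ᵖ-refl : ∀ {x} → x ≤ᵖ x) (≤ᵖ-trans : ∀ {x y z} → x ≤ᵖ y → y ≤ᵖ z → x ≤ᵖ z)
    (≤ᵖ-antisym : ∀ {x y} → x ∈ els → y ∈ els → x ≤ᵖ y → y ≤ᵖ x → x ≡ y)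
    (unique : Unique els) (bot : A) (bot∈ : bot ∈ els) (bot≤ : ∀ {y} → y ∈ els → bot ≤ᵖ y) where

    -- The hypothesis on F is the defining recursion with all terms on one side. The induction is on
    -- the fuel: it suffices that it exceeds the number of elements strictly below y, since any such
    -- z has strictly fewer below it, z itself being lost.
    möbius-unique : (F : A → ℤ) →
      (∀ {y} → y ∈ els → ∑ els (λ z → ⟦ z ≤?ᵖ y ⟧ * F z) ≡ ⟦ bot ≟ᵖ y ⟧) →
      ∀ {y} → y ∈ els → möbius els _≟ᵖ_ _≤?ᵖ_ bot y ≡ F y
    möbius-unique F rec {y} y∈ = bounded (suc (length els)) y∈ (s≤s (length-filter _ els))
      where

      split : ∀ {y} → y ∈ els → F y + ∑ (below bot y) F ≡ ⟦ bot ≟ᵖ y ⟧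
      split {y} y∈ = begin
        F y + ∑ (below bot y) F
          ≡⟨ cong₂ _+_ (sym (∑-pick _≟ᵖ_ unique y∈ F)) (∑-filter (λ z → (bot ≤?ᵖ z) ×-dec ((z ≤?ᵖ y) ×-dec ¬? (z ≟ᵖ y))) els F) ⟩
        ∑ els (λ z → ⟦ z ≟ᵖ y ⟧ * F z) + _
          ≡⟨ ∑-+ els _ _ ⟨
        ∑ els (λ z → ⟦ z ≟ᵖ y ⟧ * F z + ⟦ (bot ≤?ᵖ z) ×-dec ((z ≤?ᵖ y) ×-dec ¬? (z ≟ᵖ y)) ⟧ * F z)
          ≡⟨ ∑-cong∈ els term ⟩
        ∑ els (λ z → ⟦ z ≤?ᵖ y ⟧ * F z)
          ≡⟨ rec y∈ ⟩
        ⟦ bot ≟ᵖ y ⟧ ∎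
        where
        term : ∀ {z} → z ∈ els →
          ⟦ z ≟ᵖ y ⟧ * F z + ⟦ (bot ≤?ᵖ z) ×-dec ((z ≤?ᵖ y) ×-dec ¬? (z ≟ᵖ y)) ⟧ * F z ≡ ⟦ z ≤?ᵖ y ⟧ * F z
        term {z} z∈ rewrite ⟦⟧-× (bot ≤?ᵖ z) ((z ≤?ᵖ y) ×-dec ¬? (z ≟ᵖ y)) | ⟦⟧-yes (bot≤ z∈) (bot ≤?ᵖ z)
          with z ≟ᵖ y | z ≤?ᵖ y
        ... | yes refl | yes _ = ℤ.+-identityʳ _
        ... | yes refl | no ¬p = contradiction ≤ᵖ-refl ¬p
        ... | no _ | yes _ = ℤ.+-identityˡ _
        ... | no _ | no _ = refl

      bounded : ∀ f {y} → y ∈ els → length (below bot y) ℕ.< f → boundedMöbius f bot y ≡ F y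
      bounded (suc f) {y} y∈ (s≤s below≤f) = by-cases (bot ≟ᵖ y)
        where
        cancel : ∀ a b → a + b - b ≡ a
        cancel = solve-∀

        ih : ∀ {z} → z ∈ below bot y → boundedMöbius f bot z ≡ F z
        ih {z} z∈ with ∈-filter⁻ _ {xs = els} z∈
        ... | z∈els , p , z≤y , z≢y = bounded f z∈els (ℕ.<-≤-trans
              (length-filter-< _ _ els
                (λ w∈ (b , w≤z , w≢z) → b , ≤ᵖ-trans w≤z z≤y ,
                   λ { refl → z≢y (≤ᵖ-antisym z∈els y∈ z≤y w≤z) })
                z∈els (p , z≤y , z≢y) (λ (_ , _ , z≢z) → z≢z refl)) below≤f)

        by-cases : Dec (bot ≡ y) → boundedMöbius (suc f) bot y ≡ F y
        by-cases (yes refl) = begin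
          boundedMöbius (suc f) bot bot     ≡⟨ bounded-refl f bot ⟩
          + 1                               ≡⟨ ⟦⟧-yes refl (bot ≟ᵖ bot) ⟨
          ⟦ bot ≟ᵖ bot ⟧                    ≡⟨ split y∈ ⟨
          F bot + ∑ (below bot bot) F
            ≡⟨ cong (λ l → F bot + ∑ l F)
                 (filter-none (λ z → (bot ≤?ᵖ z) ×-dec ((z ≤?ᵖ bot) ×-dec ¬? (z ≟ᵖ bot))) (All.tabulate λ z∈ (p , q , z≢) → z≢ (≤ᵖ-antisym z∈ y∈ q p))) ⟩
          F bot + + 0                       ≡⟨ ℤ.+-identityʳ _ ⟩
          F bot                             ∎
        by-cases (no b≢y) = begin
          boundedMöbius (suc f) bot y                 ≡⟨ bounded-step f bot y b≢y (bot≤ y∈) ⟩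
          - ∑ (below bot y) (boundedMöbius f bot)     ≡⟨ cong -_ (∑-cong∈ (below bot y) ih) ⟩
          - ∑ (below bot y) F                         ≡⟨ ℤ.+-identityˡ _ ⟨
          + 0 - ∑ (below bot y) F
            ≡⟨ cong (_- ∑ (below bot y) F) (trans (sym (⟦⟧-no b≢y (bot ≟ᵖ y))) (sym (split y∈))) ⟩
          F y + ∑ (below bot y) F - ∑ (below bot y) F ≡⟨ cancel (F y) _ ⟩
          F y                                         ∎

-- Sublists and Boolean lattices

sublists-⊆ : ∀ {xs S : List A} → S ∈ sublists xs → S ⊆ xs
sublists-⊆ {xs = []} (here refl) ()
sublists-⊆ {xs = x ∷ xs} S∈ y∈ with ∈-++⁻ (sublists xs) S∈
... | inj₁ p = there (sublists-⊆ p y∈)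
... | inj₂ p with ∈-map⁻ (x ∷_) p
...   | T , T∈ , refl with y∈
...     | here refl = here refl
...     | there y∈T = there (sublists-⊆ T∈ y∈T)

filter∈sublists : ∀ {R : A → Set} (R? : Decidable R) xs → filter R? xs ∈ sublists xs
filter∈sublists R? [] = here refl
filter∈sublists R? (x ∷ xs) with R? x
... | yes _ = ∈-++⁺ʳ (sublists xs) (∈-map⁺ (x ∷_) (filter∈sublists R? xs))
... | no _ = ∈-++⁺ˡ (filter∈sublists R? xs)

unique-sublists : ∀ {xs : List A} → Unique xs → Unique (sublists xs)
unique-sublists [] = [] ∷ []
unique-sublists {xs = x ∷ xs} (x∉ ∷ u) =
  Unique.++⁺ (unique-sublists u) (Unique.map⁺ List.∷-injectiveʳ (unique-sublists u)) disjoint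
  where
  disjoint : ∀ {S} → ¬ (S ∈ sublists xs × S ∈ map (x ∷_) (sublists xs))
  disjoint (p , q) with ∈-map⁻ (x ∷_) q
  ... | T , T∈ , refl = All.lookup x∉ (sublists-⊆ p (here refl)) refl

-- Sublists keep the order of xs, so without repetitions they are determined by their elements. This
-- makes the order on flats antisymmetric for equality of lists.
sublists-antisym : ∀ {xs S T : List A} → Unique xs → S ∈ sublists xs → T ∈ sublists xs → S ⊆ T → T ⊆ S → S ≡ T
sublists-antisym [] (here refl) (here refl) _ _ = refl
sublists-antisym {xs = x ∷ xs} (x∉ ∷ u) S∈ T∈ S⊆T T⊆S with ∈-++⁻ (sublists xs) S∈ | ∈-++⁻ (sublists xs) T∈
... | inj₁ p | inj₁ q = sublists-antisym u p q S⊆T T⊆S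
... | inj₁ p | inj₂ q with ∈-map⁻ (x ∷_) q
...   | T′ , _ , refl = contradiction refl (All.lookup x∉ (sublists-⊆ p (T⊆S (here refl))))
sublists-antisym {xs = x ∷ xs} (x∉ ∷ u) S∈ T∈ S⊆T T⊆S | inj₂ p | inj₁ q with ∈-map⁻ (x ∷_) p
...   | S′ , _ , refl = contradiction refl (All.lookup x∉ (sublists-⊆ q (S⊆T (here refl))))
sublists-antisym {xs = x ∷ xs} (x∉ ∷ u) S∈ T∈ S⊆T T⊆S | inj₂ p | inj₂ q
  with ∈-map⁻ (x ∷_) p | ∈-map⁻ (x ∷_) q
...   | S′ , S′∈ , refl | T′ , T′∈ , refl =
  cong (x ∷_) (sublists-antisym u S′∈ T′∈ (tail S′∈ S⊆T) (tail T′∈ T⊆S))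
  where
  tail : ∀ {U V} → U ∈ sublists xs → x ∷ U ⊆ x ∷ V → U ⊆ V
  tail U∈ s y∈ with s (there y∈)
  ... | here refl = contradiction refl (All.lookup x∉ (sublists-⊆ U∈ y∈))
  ... | there y∈V = y∈V

alt-all-none : ∀ {R : A → Set} (R? : Decidable R) xs → (∀ {x} → x ∈ xs → ¬ R x) →
  alt xs (λ S → ⟦ All.all? R? S ⟧) ≡ + 1
alt-all-none R? [] none = refl
alt-all-none R? (x ∷ xs) none = begin
  alt xs (λ S → ⟦ All.all? R? S ⟧) - alt xs (λ S → ⟦ All.all? R? (x ∷ S) ⟧)
    ≡⟨ cong₂ _-_ (alt-all-none R? xs (none ∘ there))
         (trans (alt-cong xs (λ S → ⟦⟧-no (λ { (r ∷ _) → none (here refl) r }) (All.all? R? (x ∷ S)))) (alt-zero xs)) ⟩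
  + 1 ∎

-- An x that satisfies R can be added to S or removed from it without changing the indicator, so the
-- sublists cancel in pairs.
alt-all-some : ∀ {R : A → Set} (R? : Decidable R) xs {x} → x ∈ xs → R x →
  alt xs (λ S → ⟦ All.all? R? S ⟧) ≡ + 0
alt-all-some R? (x ∷ xs) (here refl) r =
  ℤ.i≡j⇒i-j≡0 (alt-cong xs (λ S → ⟦⟧-cong (r ∷_) (λ { (_ ∷ rs) → rs }) (All.all? R? S) (All.all? R? (x ∷ S))))
alt-all-some {R = R} R? (y ∷ xs) (there x∈) r = by-cases (R? y)
  where
  by-cases : Dec (R y) → alt (y ∷ xs) (λ S → ⟦ All.all? R? S ⟧) ≡ + 0
  by-cases (yes ry) =
    ℤ.i≡j⇒i-j≡0 (alt-cong xs (λ S → ⟦⟧-cong (ry ∷_) (λ { (_ ∷ rs) → rs }) (All.all? R? S) (All.all? R? (y ∷ S))))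
  by-cases (no ¬ry) = cong₂ _-_ (alt-all-some R? xs x∈ r)
    (trans (alt-cong xs (λ S → ⟦⟧-no (λ { (ry ∷ _) → ¬ry ry }) (All.all? R? (y ∷ S)))) (alt-zero xs))

-- The list of hyperplanes

concatMap-cartesianProduct : ∀ (xs : List A) (ys : List B) →
  concatMap (λ x → map (x ,_) ys) xs ≡ cartesianProduct xs ys
concatMap-cartesianProduct [] ys = refl
concatMap-cartesianProduct (x ∷ xs) ys = cong (map (x ,_) ys ++_) (concatMap-cartesianProduct xs ys)

module _ {k : ℕ} where

  unique-hyps : Unique (hyps k)
  unique-hyps = Unique.filter⁺ (λ p → proj₁ p Fin.<? proj₂ p)
    (subst Unique (sym (concatMap-cartesianProduct (allFin k) (allFin k)))
      (Unique.cartesianProduct⁺ (Unique.allFin⁺ k) (Unique.allFin⁺ k)))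

  ∈-hyps⁺ : ∀ {i j : Fin k} → i Fin.< j → (i , j) ∈ hyps k
  ∈-hyps⁺ {i} {j} i<j = ∈-filter⁺ (λ p → proj₁ p Fin.<? proj₂ p)
    (subst ((i , j) ∈_) (sym (concatMap-cartesianProduct (allFin k) (allFin k)))
      (∈-cartesianProduct⁺ (∈-allFin i) (∈-allFin j))) i<j

  ∈-hyps⁻ : ∀ {H : Hyp k} → H ∈ hyps k → proj₁ H Fin.< proj₂ H
  ∈-hyps⁻ H∈ = proj₂ (∈-filter⁻ (λ p → proj₁ p Fin.<? proj₂ p) {xs = concatMap (λ i → map (i ,_) (allFin k)) (allFin k)} H∈)

  -- x = 0 and y the indicator of i: this point lies exactly on the hyperplanes whose first index is not i.
  unitPoint : Fin k → Point k
  unitPoint i = (λ _ → 0ℚ) , λ j → if does (j Fin.≟ i) then 1ℚ else 0ℚ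

  unitPoint-off : ∀ i j → ¬ OnHyp (i , j) (unitPoint i)
  unitPoint-off i j eq with i Fin.≟ i
  ... | yes _ = case eq of λ ()
  ... | no i≢i = i≢i refl

  unitPoint-on : ∀ {i j} v → ¬ j ≡ i → OnHyp (j , v) (unitPoint i)
  unitPoint-on {i} {j} v j≢i with j Fin.≟ i
  ... | yes j≡i = contradiction j≡i j≢i
  ... | no _ = refl

-- Flats and Whitney's formula

module _ {k : ℕ} (dec : InterSubDec k) where

  _≟H_ : DecidableEquality (Hyp k)
  _≟H_ = ×-≡-dec Fin._≟_ Fin._≟_

  _≟F_ : DecidableEquality (List (Hyp k))
  _≟F_ = List.≡-dec _≟H_

  closure : List (Hyp k) → List (Hyp k)
  closure S = filter (dec S) (hyps k)

  InInter-closure : ∀ {S} p → InInter S p → InInter (closure S) p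
  InInter-closure {S} p pS = All.tabulate λ H∈ → proj₂ (∈-filter⁻ (dec S) {xs = hyps k} H∈) p pS

  flat-⊆ : ∀ {X} → X ∈ flats dec → X ⊆ hyps k
  flat-⊆ X∈ = sublists-⊆ (proj₁ (∈-filter⁻ (closed? dec) {xs = sublists (hyps k)} X∈))

  flat-closed : ∀ {X} → X ∈ flats dec → Closed X
  flat-closed X∈ = proj₂ (∈-filter⁻ (closed? dec) {xs = sublists (hyps k)} X∈)

  ⊆⇒≤L : ∀ {S T : List (Hyp k)} → S ⊆ T → S ≤L T
  ⊆⇒≤L S⊆T p pT = All.tabulate (All.lookup pT ∘ S⊆T)

  -- Closedness of X is what turns an inclusion of solution sets into an inclusion of lists.
  ≤L⇒⊆ : ∀ {S X} → S ⊆ hyps k → X ∈ flats dec → S ≤L X → S ⊆ X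
  ≤L⇒⊆ S⊆ X∈ S≤X H∈ = All.lookup (flat-closed X∈) (S⊆ H∈) (λ p pX → All.lookup (S≤X p pX) H∈)

  flats-antisym : ∀ {X Y} → X ∈ flats dec → Y ∈ flats dec → X ≤L Y → Y ≤L X → X ≡ Y
  flats-antisym X∈ Y∈ X≤Y Y≤X = sublists-antisym unique-hyps
    (proj₁ (∈-filter⁻ (closed? dec) X∈)) (proj₁ (∈-filter⁻ (closed? dec) Y∈))
    (≤L⇒⊆ (flat-⊆ X∈) Y∈ X≤Y) (≤L⇒⊆ (flat-⊆ Y∈) X∈ Y≤X)

  ⊆-closure : ∀ {S} → S ⊆ hyps k → S ⊆ closure S
  ⊆-closure {S} S⊆ H∈ = ∈-filter⁺ (dec S) (S⊆ H∈) (λ p pS → All.lookup pS H∈)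

  closure∈flats : ∀ S → closure S ∈ flats dec
  closure∈flats S = ∈-filter⁺ (closed? dec) (filter∈sublists (dec S) (hyps k))
    (All.tabulate λ H∈ sub → ∈-filter⁺ (dec S) H∈ (λ p pS → sub p (InInter-closure p pS)))

  []∈flats : [] ∈ flats dec
  []∈flats = ∈-filter⁺ (closed? dec) []∈sublists
    (All.tabulate λ { {i , j} H∈ sub → contradiction (sub (unitPoint i) []) (unitPoint-off i j) })
    where
    []∈sublists : [] ∈ sublists (hyps k)
    []∈sublists = subst (_∈ sublists (hyps k)) (filter-none (λ _ → no id) (All.universal (λ _ → id) (hyps k)))
      (filter∈sublists {R = λ _ → ⊥} (λ _ → no id) (hyps k))

  hyps∈flats : hyps k ∈ flats dec
  hyps∈flats = ∈-filter⁺ (closed? dec)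
    (subst (_∈ sublists (hyps k)) (filter-all (λ _ → yes refl) (All.universal (λ _ → refl) (hyps k)))
      (filter∈sublists {R = λ _ → + 0 ≡ + 0} (λ _ → yes refl) (hyps k)))
    (All.tabulate λ H∈ _ → H∈)

  spans? : (S : List (Hyp k)) → Dec (hyps k ≤L S)
  spans? S = ≤L? dec (hyps k) S

  generates? : (X S : List (Hyp k)) → Dec (S ≤L X × X ≤L S)
  generates? X S = ≤L? dec S X ×-dec ≤L? dec X S

  _∈H?_ : (H : Hyp k) (X : List (Hyp k)) → Dec (H ∈ X)
  _∈H?_ = mem? _≟H_

  -- Whitney's formula: summed over the flats X below Y, the signed numbers of generating sets
  -- of X give the signed number of all subsets of Y.
  whitney : List (Hyp k) → ℤ
  whitney X = alt (hyps k) (λ S → ⟦ generates? X S ⟧)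

  whitney-recursion : ∀ {Y} → Y ∈ flats dec → ∑ (flats dec) (λ X → ⟦ ≤L? dec X Y ⟧ * whitney X) ≡ ⟦ [] ≟F Y ⟧
  whitney-recursion {Y} Y∈ = begin
    ∑ (flats dec) (λ X → ⟦ ≤L? dec X Y ⟧ * whitney X)
      ≡⟨ ∑-cong (flats dec) (λ X → sym (alt-*ˡ ⟦ ≤L? dec X Y ⟧ (hyps k) _)) ⟩
    ∑ (flats dec) (λ X → alt (hyps k) (λ S → ⟦ ≤L? dec X Y ⟧ * ⟦ generates? X S ⟧))
      ≡⟨ alt-∑ (hyps k) (flats dec) _ ⟨
    alt (hyps k) (λ S → ∑ (flats dec) (λ X → ⟦ ≤L? dec X Y ⟧ * ⟦ generates? X S ⟧))
      -- Each S generates exactly one flat, its closure, and this lies below Y precisely when S is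
      -- contained in Y.
      ≡⟨ alt-cong⊆ (hyps k) only-closure ⟩
    alt (hyps k) (λ S → ⟦ All.all? (_∈H? Y) S ⟧)
      ≡⟨ boolean (flat-⊆ Y∈) ⟩
    ⟦ [] ≟F Y ⟧ ∎
    where
    only-closure : ∀ S → S ⊆ hyps k →
      ∑ (flats dec) (λ X → ⟦ ≤L? dec X Y ⟧ * ⟦ generates? X S ⟧) ≡ ⟦ All.all? (_∈H? Y) S ⟧
    only-closure S S⊆ = begin
      ∑ (flats dec) (λ X → ⟦ ≤L? dec X Y ⟧ * ⟦ generates? X S ⟧)
        ≡⟨ ∑-cong∈ (flats dec) (λ {X} X∈ → trans (ℤ.*-comm ⟦ ≤L? dec X Y ⟧ ⟦ generates? X S ⟧)
             (cong (_* ⟦ ≤L? dec X Y ⟧) (⟦⟧-cong (to X∈) from (generates? X S) (X ≟F closure S)))) ⟩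
      ∑ (flats dec) (λ X → ⟦ X ≟F closure S ⟧ * ⟦ ≤L? dec X Y ⟧)
        ≡⟨ ∑-pick _≟F_ (Unique.filter⁺ (closed? dec) (unique-sublists unique-hyps)) (closure∈flats S) _ ⟩
      ⟦ ≤L? dec (closure S) Y ⟧
        ≡⟨ ⟦⟧-cong
             (λ cl≤Y → All.tabulate (≤L⇒⊆ (flat-⊆ (closure∈flats S)) Y∈ cl≤Y ∘ ⊆-closure S⊆))
             (λ S∈Y p pY → InInter-closure p (All.map (All.lookup pY) S∈Y))
             (≤L? dec (closure S) Y) (All.all? (_∈H? Y) S) ⟩
      ⟦ All.all? (_∈H? Y) S ⟧ ∎
      where
      to : ∀ {X} → X ∈ flats dec → S ≤L X × X ≤L S → X ≡ closure S
      to X∈ (S≤X , X≤S) = flats-antisym X∈ (closure∈flats S)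
        (λ p pcl → X≤S p (⊆⇒≤L (⊆-closure S⊆) p pcl)) (λ p pX → InInter-closure p (S≤X p pX))
      from : ∀ {X} → X ≡ closure S → S ≤L X × X ≤L S
      from refl = ⊆⇒≤L (⊆-closure S⊆) , InInter-closure

    boolean : ∀ {Y} → Y ⊆ hyps k → alt (hyps k) (λ S → ⟦ All.all? (_∈H? Y) S ⟧) ≡ ⟦ [] ≟F Y ⟧
    boolean {[]} _ = alt-all-none (_∈H? []) (hyps k) (λ _ ())
    boolean {H ∷ Y} Y⊆ = alt-all-some (_∈H? (H ∷ Y)) (hyps k) (Y⊆ (here refl)) (here refl)

  möbius-spanning : möbius (flats dec) _≟F_ (≤L? dec) [] (hyps k) ≡ alt (hyps k) (λ S → ⟦ spans? S ⟧)
  möbius-spanning = begin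
    möbius (flats dec) _≟F_ (≤L? dec) [] (hyps k)
      ≡⟨ möbius-unique (flats dec) _≟F_ (≤L? dec) (λ {S} p pS → pS) (λ S≤T T≤U p pU → S≤T p (T≤U p pU)) flats-antisym
           (Unique.filter⁺ (closed? dec) (unique-sublists unique-hyps)) [] []∈flats (λ _ _ _ → [])
           whitney whitney-recursion hyps∈flats ⟩
    whitney (hyps k)
      ≡⟨ alt-cong⊆ (hyps k) (λ S S⊆ → ⟦⟧-cong proj₂ (⊆⇒≤L S⊆ ,_) (generates? (hyps k) S) (spans? S)) ⟩
    alt (hyps k) (λ S → ⟦ spans? S ⟧) ∎

-- The Gandhi recursion

gandhi : ℕ → ℕ → ℤ
gandhi zero x = + x
gandhi (suc m) x = + x * + x * (gandhi m (suc x) - gandhi m x)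

-- The weight of M pairs of an odd and an even row when r rows are postponed so far; f evaluates
-- the postponed rows at the end.
pairs : (ℕ → ℤ) → ℕ → ℕ → ℤ
pairs f zero r = f r
pairs f (suc M) r = + suc r * pairs f M (suc r) - + r * (+ r * pairs f M r)

pos-suc-! : ∀ r → + (suc r ℕ.!) ≡ + suc r * + (r ℕ.!)
pos-suc-! r = ℤ.pos-* (suc r) (r ℕ.!)

-- The normalisation by r!/(r+1) turns one recursion into the other: the factor r+1 split off from
-- (r+1)! completes the square in front of the difference.
pairs-gandhi : ∀ f j → (∀ r → + suc r * f (suc r) ≡ + (r ℕ.!) * gandhi j (suc r)) →
  ∀ M r → + suc r * pairs f M (suc r) ≡ + (r ℕ.!) * gandhi (M ℕ.+ j) (suc r)
pairs-gandhi f j base zero r = base r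
pairs-gandhi f j base (suc M) r = begin
  c * (+ suc (suc r) * pairs f M (suc (suc r)) - c * (c * pairs f M (suc r)))
    ≡⟨ cong₂ (λ a b → c * (a - c * b)) (pairs-gandhi f j base M (suc r)) (pairs-gandhi f j base M r) ⟩
  c * (+ (suc r ℕ.!) * gandhi (M ℕ.+ j) (suc (suc r)) - c * (+ (r ℕ.!) * gandhi (M ℕ.+ j) (suc r)))
    ≡⟨ cong (λ a → c * (a * gandhi (M ℕ.+ j) (suc (suc r)) - c * (+ (r ℕ.!) * gandhi (M ℕ.+ j) (suc r)))) (pos-suc-! r) ⟩
  c * (c * + (r ℕ.!) * gandhi (M ℕ.+ j) (suc (suc r)) - c * (+ (r ℕ.!) * gandhi (M ℕ.+ j) (suc r)))
    ≡⟨ lemma c (+ (r ℕ.!)) _ _ ⟩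
  + (r ℕ.!) * (c * c * (gandhi (M ℕ.+ j) (suc (suc r)) - gandhi (M ℕ.+ j) (suc r))) ∎
  where
  c = + suc r
  lemma : ∀ c f g h → c * (c * f * g - c * (f * h)) ≡ f * (c * c * (g - h))
  lemma = solve-∀

-- While no row is postponed, a constrained row has no choice, so the first pair only raises r to 1
-- and adds no Gandhi step. The index j records the step that the base values may already contain: 1
-- for r!, 0 for (r-1)!.
pairs-zero : ∀ f j → (∀ r → + suc r * f (suc r) ≡ + (r ℕ.!) * gandhi j (suc r)) →
  ∀ M → pairs f (suc M) 0 ≡ gandhi (M ℕ.+ j) 1
pairs-zero f j base M = begin
  + 1 * pairs f M 1 - + 0 * (+ 0 * pairs f M 0) ≡⟨ lemma₁ (pairs f M 1) (pairs f M 0) ⟩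
  + 1 * pairs f M 1                             ≡⟨ pairs-gandhi f j base M 0 ⟩
  + 1 * gandhi (M ℕ.+ j) 1                      ≡⟨ ℤ.*-identityˡ _ ⟩
  gandhi (M ℕ.+ j) 1                            ∎
  where
  lemma₁ : ∀ a b → + 1 * a - + 0 * (+ 0 * b) ≡ + 1 * a
  lemma₁ = solve-∀

double : ℕ → ℕ
double zero = zero
double (suc n) = suc (suc (double n))

2*-double : ∀ n → 2 ℕ.* n ≡ double n
2*-double zero = refl
2*-double (suc n) = trans (cong suc (ℕ.+-suc n (n ℕ.+ 0))) (cong (λ k → suc (suc k)) (2*-double n))

odd-position : ∀ s → suc (double s) % 2 ≡ 1
odd-position zero = refl
odd-position (suc s) = odd-position s

even-position : ∀ s → suc (suc (double s)) % 2 ≡ 0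
even-position zero = refl
even-position (suc s) = even-position s

-- Permanents, expanded row by row

module _ {m : ℕ} where

  _∈?_ : (a : Fin m) (u : List (Fin m)) → Dec (a ∈ u)
  _∈?_ = mem? Fin._≟_

  below : ℕ → Fin m → ℤ
  below t a = ⟦ toℕ a ℕ.<? t ⟧

  ∑-∈ : ∀ {u} → Unique u → ∑ (allFin m) (λ a → ⟦ a ∈? u ⟧) ≡ + length u
  ∑-∈ {[]} [] = ∑-zero (allFin m)
  ∑-∈ {x ∷ u} (x∉u ∷ uniq) = begin
    ∑ (allFin m) (λ a → ⟦ a ∈? (x ∷ u) ⟧)
      ≡⟨ ∑-cong (allFin m) term ⟩
    ∑ (allFin m) (λ a → ⟦ a Fin.≟ x ⟧ * + 1 + ⟦ a ∈? u ⟧)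
      ≡⟨ ∑-+ (allFin m) _ _ ⟩
    ∑ (allFin m) (λ a → ⟦ a Fin.≟ x ⟧ * + 1) + ∑ (allFin m) (λ a → ⟦ a ∈? u ⟧)
      ≡⟨ cong₂ _+_ (∑-pick Fin._≟_ (Unique.allFin⁺ m) (∈-allFin x) (λ _ → + 1)) (∑-∈ uniq) ⟩
    + 1 + + length u ∎
    where
    term : ∀ a → ⟦ a ∈? (x ∷ u) ⟧ ≡ ⟦ a Fin.≟ x ⟧ * + 1 + ⟦ a ∈? u ⟧
    term a with a Fin.≟ x
    ... | yes refl rewrite ⟦⟧-no (λ a∈u → All.lookup x∉u a∈u refl) (a ∈? u) = refl
    ... | no a≢x with a ∈? u
    ...   | yes _ = refl
    ...   | no _ = refl

∑-tabulate-suc : ∀ m (f : Fin (suc m) → ℤ) → ∑ (allFin (suc m)) f ≡ f zero + ∑ (allFin m) (f ∘ suc)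
∑-tabulate-suc m f = +-congˡ (f zero)
  (trans (cong (λ xs → ∑ xs f) (sym (List.map-tabulate id suc))) (∑-map suc (allFin m) f))

∑-below : ∀ m t → t ≤ m → ∑ (allFin m) (below t) ≡ + t
∑-below m zero z≤n = ∑-zero (allFin m)
∑-below (suc m) (suc t) (s≤s t≤m) = trans (∑-tabulate-suc m (below (suc t)))
  (cong (λ s → + 1 + s) (trans (∑-cong (allFin m) (λ a → ⟦⟧-cong ℕ.≤-pred s≤s (toℕ (Fin.suc a) ℕ.<? suc t) (toℕ a ℕ.<? t))) (∑-below m t t≤m)))

module _ {m : ℕ} where

  -- The a < t outside u number t - |u|; r stands for this difference.
  ∑-unused-below : ∀ {t u r} → t ≤ m → Unique u → All (λ a → toℕ a < t) u → length u ℕ.+ r ≡ t →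
    ∑ (allFin m) (λ a → ⟦ ¬? (a ∈? u) ⟧ * below t a) ≡ + r
  ∑-unused-below {t} {u} {r} t≤m uniq u<t eq = begin
    ∑ (allFin m) (λ a → ⟦ ¬? (a ∈? u) ⟧ * below t a)
      ≡⟨ ∑-cong (allFin m) term ⟩
    ∑ (allFin m) (λ a → below t a - ⟦ a ∈? u ⟧)
      ≡⟨ ∑-- (allFin m) _ _ ⟩
    ∑ (allFin m) (below t) - ∑ (allFin m) (λ a → ⟦ a ∈? u ⟧)
      ≡⟨ cong₂ _-_ (∑-below m t t≤m) (∑-∈ uniq) ⟩
    + t - + length u
      ≡⟨ cong (λ k → + k - + length u) (sym eq) ⟩
    + (length u ℕ.+ r) - + length u
      ≡⟨ lemma (+ length u) (+ r) ⟩
    + r ∎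
    where
    lemma : ∀ a b → a + b - a ≡ b
    lemma = solve-∀
    term : ∀ a → ⟦ ¬? (a ∈? u) ⟧ * below t a ≡ below t a - ⟦ a ∈? u ⟧
    term a with a ∈? u
    ... | no _ = trans (ℤ.*-identityˡ _) (sym (ℤ.+-identityʳ _))
    ... | yes a∈u rewrite ⟦⟧-yes (All.lookup u<t a∈u) (toℕ a ℕ.<? t) = refl

  -- The permanent of the rows ws on the columns outside u.
  per : List (Fin m → ℤ) → List (Fin m) → ℤ
  per [] u = + 1
  per (w ∷ ws) u = ∑ (allFin m) (λ a → ⟦ ¬? (a ∈? u) ⟧ * (w a * per ws (a ∷ u)))

  per-cong : ∀ ws {u v} → u ⊆ v → v ⊆ u → per ws u ≡ per ws v
  per-cong [] _ _ = refl
  per-cong (w ∷ ws) {u} {v} u⊆v v⊆u = ∑-cong (allFin m) λ a → cong₂ _*_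
    (⟦⟧-cong (λ a∉ → a∉ ∘ v⊆u) (λ a∉ → a∉ ∘ u⊆v) (¬? (a ∈? u)) (¬? (a ∈? v)))
    (cong (w a *_) (per-cong ws (∷-mono u⊆v) (∷-mono v⊆u)))
    where
    ∷-mono : ∀ {a u v} → u ⊆ v → a ∷ u ⊆ a ∷ v
    ∷-mono s (here p) = here p
    ∷-mono s (there p) = there (s p)

  -- The columns of two rows may be chosen in either order because only the set of used columns
  -- matters afterwards. This symmetry is what permits a row to be postponed.
  per-swap : ∀ w w′ ws u → per (w ∷ w′ ∷ ws) u ≡ per (w′ ∷ w ∷ ws) u
  per-swap w w′ ws u = begin
    per (w ∷ w′ ∷ ws) u
      ≡⟨ ∑-cong (allFin m) (λ a → expand w w′ a) ⟩
    ∑ (allFin m) (λ a → ∑ (allFin m) (term w w′ a))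
      ≡⟨ ∑-swap (allFin m) (allFin m) _ ⟩
    ∑ (allFin m) (λ b → ∑ (allFin m) (λ a → term w w′ a b))
      ≡⟨ ∑-cong (allFin m) (λ b → ∑-cong (allFin m) (λ a → term-sym a b)) ⟩
    ∑ (allFin m) (λ b → ∑ (allFin m) (term w′ w b))
      ≡⟨ ∑-cong (allFin m) (λ b → expand w′ w b) ⟨
    per (w′ ∷ w ∷ ws) u ∎
    where
    term : (w w′ : Fin m → ℤ) → Fin m → Fin m → ℤ
    term w w′ a b = ⟦ ¬? (a ∈? u) ⟧ * (w a * (⟦ ¬? (b ∈? (a ∷ u)) ⟧ * (w′ b * per ws (b ∷ a ∷ u))))

    expand : ∀ w w′ a → ⟦ ¬? (a ∈? u) ⟧ * (w a * per (w′ ∷ ws) (a ∷ u)) ≡ ∑ (allFin m) (term w w′ a)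
    expand w w′ a = sym (trans (∑-*ˡ ⟦ ¬? (a ∈? u) ⟧ (allFin m) _)
      (cong (⟦ ¬? (a ∈? u) ⟧ *_) (∑-*ˡ (w a) (allFin m) _)))

    outside : ∀ {a b} → ¬ a ∈ u → ¬ b ∈ a ∷ u → ¬ a ∈ b ∷ u
    outside a∉ b∉ (here refl) = b∉ (here refl)
    outside a∉ b∉ (there a∈) = a∉ a∈

    lemma : ∀ a b x y z → a * (x * (b * (y * z))) ≡ (a * b) * (x * y * z)
    lemma = solve-∀

    term-sym : ∀ a b → term w w′ a b ≡ term w′ w b a
    term-sym a b = begin
      term w w′ a b
        ≡⟨ lemma ⟦ ¬? (a ∈? u) ⟧ ⟦ ¬? (b ∈? (a ∷ u)) ⟧ (w a) (w′ b) _ ⟩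
      ⟦ ¬? (a ∈? u) ⟧ * ⟦ ¬? (b ∈? (a ∷ u)) ⟧ * (w a * w′ b * per ws (b ∷ a ∷ u))
        ≡⟨ cong₂ _*_ (trans (sym (⟦⟧-× (¬? (a ∈? u)) (¬? (b ∈? (a ∷ u))))) (trans
              (⟦⟧-cong (λ (p , q) → (λ b∈ → q (there b∈)) , outside p q)
                (λ (p , q) → (λ a∈ → q (there a∈)) , outside p q)
                (¬? (a ∈? u) ×-dec ¬? (b ∈? (a ∷ u))) (¬? (b ∈? u) ×-dec ¬? (a ∈? (b ∷ u))))
              (⟦⟧-× (¬? (b ∈? u)) (¬? (a ∈? (b ∷ u))))))
             (cong₂ _*_ (ℤ.*-comm (w a) (w′ b)) (per-cong ws ∷-swap ∷-swap)) ⟩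
      ⟦ ¬? (b ∈? u) ⟧ * ⟦ ¬? (a ∈? (b ∷ u)) ⟧ * (w′ b * w a * per ws (a ∷ b ∷ u))
        ≡⟨ lemma ⟦ ¬? (b ∈? u) ⟧ ⟦ ¬? (a ∈? (b ∷ u)) ⟧ (w′ b) (w a) _ ⟨
      term w′ w b a ∎
      where
      ∷-swap : ∀ {a b : Fin m} {u} → a ∷ b ∷ u ⊆ b ∷ a ∷ u
      ∷-swap (here p) = there (here p)
      ∷-swap (there (here p)) = here p
      ∷-swap (there (there p)) = there (there p)

  per-↭ : ∀ {ws ws′} → ws ↭ ws′ → ∀ u → per ws u ≡ per ws′ u
  per-↭ ↭.refl u = refl
  per-↭ (prep w p) u = ∑-cong (allFin m) λ a → cong (λ x → ⟦ ¬? (a ∈? u) ⟧ * (w a * x)) (per-↭ p (a ∷ u))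
  per-↭ (swap {xs} w w′ p) u = trans (per-swap w w′ xs u)
    (∑-cong (allFin m) λ a → cong (λ x → ⟦ ¬? (a ∈? u) ⟧ * (w′ a * x))
      (∑-cong (allFin m) λ b → cong (λ x → ⟦ ¬? (b ∈? (a ∷ u)) ⟧ * (w b * x)) (per-↭ p (b ∷ a ∷ u))))
  per-↭ (↭.trans p q) u = trans (per-↭ p u) (per-↭ q u)

  per-head-cong : ∀ {w w′ : Fin m → ℤ} → (∀ a → w a ≡ w′ a) → ∀ ws u → per (w ∷ ws) u ≡ per (w′ ∷ ws) u
  per-head-cong eq ws u =
    ∑-cong (allFin m) λ a → cong (λ x → ⟦ ¬? (a ∈? u) ⟧ * (x * per ws (a ∷ u))) (eq a)

  per-head-- : ∀ (w w′ : Fin m → ℤ) ws u →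
    per ((λ a → w a - w′ a) ∷ ws) u ≡ per (w ∷ ws) u - per (w′ ∷ ws) u
  per-head-- w w′ ws u = trans
    (∑-cong (allFin m) λ a → lemma ⟦ ¬? (a ∈? u) ⟧ (w a) (w′ a) (per ws (a ∷ u)))
    (∑-- (allFin m) _ _)
    where
    lemma : ∀ a b c d → a * ((b - c) * d) ≡ a * (b * d) - a * (c * d)
    lemma = solve-∀

  -- As all used columns lie below t, exactly r columns below t are available, whatever was chosen
  -- before. In the applications K is supplied by the induction, which sees the number r but not the
  -- chosen columns.
  per-below : ∀ {t u r} ws K → t ≤ m → Unique u → All (λ a → toℕ a < t) u → length u ℕ.+ r ≡ t →
    (∀ {a} → ¬ a ∈ u → toℕ a < t → per ws (a ∷ u) ≡ K) → per (below t ∷ ws) u ≡ + r * K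
  per-below {t} {u} {r} ws K t≤m uniq u<t eq const = begin
    per (below t ∷ ws) u
      ≡⟨ ∑-cong (allFin m) term ⟩
    ∑ (allFin m) (λ a → ⟦ ¬? (a ∈? u) ⟧ * below t a * K)
      ≡⟨ ∑-*ʳ K (allFin m) _ ⟩
    ∑ (allFin m) (λ a → ⟦ ¬? (a ∈? u) ⟧ * below t a) * K
      ≡⟨ cong (_* K) (∑-unused-below t≤m uniq u<t eq) ⟩
    + r * K ∎
    where
    term : ∀ a → ⟦ ¬? (a ∈? u) ⟧ * (below t a * per ws (a ∷ u)) ≡ ⟦ ¬? (a ∈? u) ⟧ * below t a * K
    term a with a ∈? u | toℕ a ℕ.<? t
    ... | yes _ | _ = refl
    ... | no _ | no _ = refl
    ... | no a∉ | yes a<t = trans (cong (λ x → + 1 * (+ 1 * x)) (const a∉ a<t)) (sym (ℤ.*-assoc (+ 1) (+ 1) K))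

  weight : ∀ {l} → Vec (Fin m → ℤ) l → Vec (Fin m) l → List (Fin m) → ℤ
  weight [] [] u = + 1
  weight (w ∷ ws) (a ∷ v) u = ⟦ ¬? (a ∈? u) ⟧ * (w a * weight ws v (a ∷ u))

  ∑-weight : ∀ {l} (ws : Vec (Fin m → ℤ) l) u → ∑ (allVecs m l) (λ v → weight ws v u) ≡ per (Vec.toList ws) u
  ∑-weight [] u = refl
  ∑-weight {suc l} (w ∷ ws) u = trans (∑-concatMap _ (allFin m) _) (∑-cong (allFin m) λ a → begin
    ∑ (map (a ∷_) (allVecs m l)) (λ v → weight (w ∷ ws) v u)
      ≡⟨ ∑-map (a ∷_) (allVecs m l) _ ⟩
    ∑ (allVecs m l) (λ v → ⟦ ¬? (a ∈? u) ⟧ * (w a * weight ws v (a ∷ u)))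
      ≡⟨ ∑-*ˡ ⟦ ¬? (a ∈? u) ⟧ (allVecs m l) _ ⟩
    ⟦ ¬? (a ∈? u) ⟧ * ∑ (allVecs m l) (λ v → w a * weight ws v (a ∷ u))
      ≡⟨ cong (⟦ ¬? (a ∈? u) ⟧ *_) (trans (∑-*ˡ (w a) (allVecs m l) _) (cong (w a *_) (∑-weight ws (a ∷ u)))) ⟩
    ⟦ ¬? (a ∈? u) ⟧ * (w a * per (Vec.toList ws) (a ∷ u)) ∎)

  Injective : ∀ {l} → Vec (Fin m) l → Set
  Injective v = ∀ i j → lookup v i ≡ lookup v j → i ≡ j

  injective-∷ : ∀ {l a} {v : Vec (Fin m) l} → Injective v → (∀ i → ¬ lookup v i ≡ a) → Injective (a ∷ v)
  injective-∷ inj a∉ zero zero eq = refl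
  injective-∷ inj a∉ zero (suc j) eq = contradiction (sym eq) (a∉ j)
  injective-∷ inj a∉ (suc i) zero eq = contradiction eq (a∉ i)
  injective-∷ inj a∉ (suc i) (suc j) eq = cong suc (inj i j eq)

  injective-tail : ∀ {l a} {v : Vec (Fin m) l} → Injective (a ∷ v) → Injective v
  injective-tail inj i j eq = Fin.suc-injective (inj (suc i) (suc j) eq)

  injective-head : ∀ {l a} {v : Vec (Fin m) l} → Injective (a ∷ v) → ∀ i → ¬ lookup v i ≡ a
  injective-head inj i eq with () ← inj (suc i) zero eq

  -- The list u of used columns carries injectivity along: an entry must avoid u and then joins it.
  -- The decision d is arbitrary so that the recursive call can take a transported one.
  weight-indicator : ∀ {l} {C : Fin l → Fin m → Set} (C? : ∀ i a → Dec (C i a)) (ws : Vec (Fin m → ℤ) l) →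
    (∀ i a → lookup ws i a ≡ ⟦ C? i a ⟧) → ∀ v u →
    (d : Dec (Injective v × (∀ i → C i (lookup v i)) × (∀ i → ¬ lookup v i ∈ u))) →
    weight ws v u ≡ ⟦ d ⟧
  weight-indicator C? [] eq [] u d = sym (⟦⟧-yes ((λ ()) , (λ ()) , (λ ())) d)
  weight-indicator {C = C} C? (w ∷ ws) eq (a ∷ v) u d rewrite eq zero a with a ∈? u | C? zero a
  ... | yes a∈u | _ = sym (⟦⟧-no (λ (_ , _ , ∉u) → ∉u zero a∈u) d)
  ... | no _ | no ¬c = sym (⟦⟧-no (λ (_ , c , _) → ¬c (c zero)) d)
  ... | no a∉u | yes c = begin
    + 1 * (+ 1 * weight ws v (a ∷ u)) ≡⟨ trans (ℤ.*-identityˡ _) (ℤ.*-identityˡ _) ⟩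
    weight ws v (a ∷ u)
      ≡⟨ weight-indicator (C? ∘ suc) ws (eq ∘ suc) v (a ∷ u) (map′ to from d) ⟩
    ⟦ map′ to from d ⟧ ≡⟨ ⟦⟧-cong from to (map′ to from d) d ⟩
    ⟦ d ⟧ ∎
    where
    to : _ → _
    to (inj , cs , ∉u) = injective-tail inj , cs ∘ suc ,
      λ { i (here p) → injective-head inj i p ; i (there p) → ∉u (suc i) p }
    from : (Injective v × (∀ i → C (suc i) (lookup v i)) × (∀ i → ¬ lookup v i ∈ (a ∷ u))) →
      Injective (a ∷ v) × (∀ i → C i (lookup (a ∷ v) i)) × (∀ i → ¬ lookup (a ∷ v) i ∈ u)
    from (inj , cs , ∉u) = injective-∷ inj (λ i p → ∉u i (here p)) ,
      (λ { zero → c ; (suc i) → cs i }) , (λ { zero → a∉u ; (suc i) → ∉u i ∘ there })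

rowsFrom : (ℕ → A) → ℕ → (l : ℕ) → Vec A l
rowsFrom ρ t zero = []
rowsFrom ρ t (suc l) = ρ t ∷ rowsFrom ρ (suc t) l

lookup-rowsFrom : ∀ (ρ : ℕ → A) t {l} (i : Fin l) → lookup (rowsFrom ρ t l) i ≡ ρ (t ℕ.+ toℕ i)
lookup-rowsFrom ρ t zero = cong ρ (sym (ℕ.+-identityʳ t))
lookup-rowsFrom ρ t (suc i) = trans (lookup-rowsFrom ρ (suc t) i) (cong ρ (sym (ℕ.+-suc t (toℕ i))))

-- Dumont permutations

dumontCount : ℕ → ℕ
dumontCount m = length (filter (λ σ → isPerm? σ ×-dec isDumont? σ) (allVecs m m))

module _ {m : ℕ} where

  Dumont : ℕ → Fin m → Set
  Dumont t a = (suc t % 2 ≡ 1 → suc t ≤ pos a) × (suc t % 2 ≡ 0 → pos a < suc t)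

  dumont? : ∀ t a → Dec (Dumont t a)
  dumont? t a = ((suc t % 2 ℕ.≟ 1) →-dec (suc t ℕ.≤? pos a)) ×-dec ((suc t % 2 ℕ.≟ 0) →-dec (pos a ℕ.<? suc t))

  dumontRow : ℕ → Fin m → ℤ
  dumontRow t a = ⟦ dumont? t a ⟧

  free : Fin m → ℤ
  free _ = + 1

  dumontRow-odd : ∀ s a → dumontRow (double s) a ≡ free a - below (double s) a
  dumontRow-odd s a = trans (⟦⟧-cong
    (λ (o , _) a<t → ℕ.<⇒≱ a<t (ℕ.≤-pred (o (odd-position s))))
    (λ a≮t → (λ _ → s≤s (ℕ.≮⇒≥ a≮t)) , λ e → contradiction (trans (sym e) (odd-position s)) λ ())
    (dumont? (double s) a) (¬? (toℕ a ℕ.<? double s))) (⟦⟧-¬ (toℕ a ℕ.<? double s))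

  dumontRow-even : ∀ s a → dumontRow (suc (double s)) a ≡ below (suc (double s)) a
  dumontRow-even s a = ⟦⟧-cong (λ (_ , e) → ℕ.≤-pred (e (even-position s)))
    (λ a<t → (λ o → contradiction (trans (sym o) (even-position s)) λ ()) , λ _ → s≤s a<t)
    (dumont? (suc (double s)) a) (toℕ a ℕ.<? suc (double s))

  per-free : ∀ r {u} → Unique u → length u ℕ.+ r ≡ m → per (replicate r free) u ≡ + (r ℕ.!)
  per-free zero uniq eq = refl
  per-free (suc r) {u} uniq eq = begin
    per (free ∷ replicate r free) u
      -- Every column is below m, so an all-ones row is a bounded row with bound m.
      ≡⟨ per-head-cong (λ a → sym (⟦⟧-yes (Fin.toℕ<n a) (toℕ a ℕ.<? m))) (replicate r free) u ⟩
    per (below m ∷ replicate r free) u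
      ≡⟨ per-below (replicate r free) (+ (r ℕ.!)) ℕ.≤-refl uniq (All.universal Fin.toℕ<n u) eq
           (λ a∉u _ → per-free r (All.tabulate (λ { b∈u refl → a∉u b∈u }) ∷ uniq) (trans (sym (ℕ.+-suc (length u) r)) eq)) ⟩
    + suc r * + (r ℕ.!) ≡⟨ pos-suc-! r ⟨
    + (suc r ℕ.!) ∎

  -- Odd rows are split as 1 - [a < t].  The all-ones rows are moved to the end, where
  -- the r of them match the r columns below t that are still unused.
  per-dumont : ∀ M s r {u} → double (s ℕ.+ M) ≡ m → Unique u → All (λ a → toℕ a < double s) u →
    length u ℕ.+ r ≡ double s →
    per (Vec.toList (rowsFrom dumontRow (double s) (double M)) ++ replicate r free) u ≡ pairs (λ k → + (k ℕ.!)) M r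
  per-dumont zero s r tot uniq u<t eq = per-free r uniq (trans eq (trans (cong double (sym (ℕ.+-identityʳ s))) tot))
  per-dumont (suc M) s r {u} tot uniq u<t eq = begin
    per (dumontRow t ∷ dumontRow (suc t) ∷ rest r) u
      ≡⟨ per-head-cong (dumontRow-odd s) (dumontRow (suc t) ∷ rest r) u ⟩
    per ((λ a → free a - below t a) ∷ dumontRow (suc t) ∷ rest r) u
      ≡⟨ per-head-- free (below t) (dumontRow (suc t) ∷ rest r) u ⟩
    per (free ∷ dumontRow (suc t) ∷ rest r) u - per (below t ∷ dumontRow (suc t) ∷ rest r) u
      ≡⟨ cong₂ _-_ deferred constrained ⟩
    + suc r * pairs f M (suc r) - + r * (+ r * pairs f M r) ∎
    where
    f = λ k → + (k ℕ.!)
    t = double s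
    rows = Vec.toList (rowsFrom dumontRow (suc (suc t)) (double M))
    rest = λ r → rows ++ replicate r free

    double-mono : ∀ {a b} → a ≤ b → double a ≤ double b
    double-mono z≤n = z≤n
    double-mono (s≤s p) = s≤s (s≤s (double-mono p))

    t+2≤m : suc (suc t) ≤ m
    t+2≤m = ℕ.≤-trans (double-mono (ℕ.≤-trans (s≤s (ℕ.m≤m+n s M)) (ℕ.≤-reflexive (sym (ℕ.+-suc s M))))) (ℕ.≤-reflexive tot)

    unique-∷ : ∀ {a : Fin m} {u} → ¬ a ∈ u → Unique u → Unique (a ∷ u)
    unique-∷ a∉u uniq = All.tabulate (λ { b∈u refl → a∉u b∈u }) ∷ uniq

    widen : ∀ {t u} → All (λ a → toℕ a < t) u → All (λ (a : Fin m) → toℕ a < suc t) u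
    widen = All.map ℕ.m≤n⇒m≤1+n

    tot′ : double (suc s ℕ.+ M) ≡ m
    tot′ = trans (cong double (sym (ℕ.+-suc s M))) tot

    even : ∀ r {u} → Unique u → All (λ a → toℕ a < suc t) u → length u ℕ.+ r ≡ suc t →
      per (dumontRow (suc t) ∷ rest r) u ≡ + r * pairs f M r
    even r {u} uniq u< eq = trans (per-head-cong (dumontRow-even s) (rest r) u)
      (per-below (rest r) (pairs f M r) (ℕ.<⇒≤ t+2≤m) uniq u< eq
        (λ a∉u a< → per-dumont M (suc s) r tot′ (unique-∷ a∉u uniq) (widen (a< ∷ u<)) (cong suc eq)))

    deferred : per (free ∷ dumontRow (suc t) ∷ rest r) u ≡ + suc r * pairs f M (suc r)
    deferred = trans (per-↭ (↭.↭-sym (shift free (dumontRow (suc t) ∷ rows) (replicate r free))) u)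
      (even (suc r) uniq (widen u<t) (trans (ℕ.+-suc (length u) r) (cong suc eq)))

    constrained : per (below t ∷ dumontRow (suc t) ∷ rest r) u ≡ + r * (+ r * pairs f M r)
    constrained = per-below (dumontRow (suc t) ∷ rest r) _ (ℕ.≤-trans (ℕ.m≤n+m t 2) t+2≤m) uniq u<t eq
      (λ a∉u a<t → even r (unique-∷ a∉u uniq) (widen (a<t ∷ u<t)) (cong suc eq))

dumontCount-pairs : ∀ M → + dumontCount (double M) ≡ pairs (λ k → + (k ℕ.!)) M 0
dumontCount-pairs M = begin
  + dumontCount m
    ≡⟨ length-filter-∑ _ (allVecs m m) ⟩
  ∑ (allVecs m m) (λ σ → ⟦ isPerm? σ ×-dec isDumont? σ ⟧)
    ≡⟨ ∑-cong (allVecs m m) indicator ⟨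
  ∑ (allVecs m m) (λ σ → weight rows σ [])
    ≡⟨ ∑-weight rows [] ⟩
  per (Vec.toList rows) []
    ≡⟨ cong (λ ws → per ws []) (List.++-identityʳ (Vec.toList rows)) ⟨
  per (Vec.toList rows ++ []) []
    ≡⟨ per-dumont M 0 0 refl [] [] refl ⟩
  pairs (λ k → + (k ℕ.!)) M 0 ∎
  where
  m = double M
  rows = rowsFrom dumontRow 0 m
  indicator : ∀ σ → weight rows σ [] ≡ ⟦ isPerm? σ ×-dec isDumont? σ ⟧
  indicator σ = trans
    (weight-indicator (λ i a → dumont? (toℕ i) a) rows (λ i a → cong (λ ρ → ρ a) (lookup-rowsFrom dumontRow 0 i)) σ []
      (map′ (λ (p , q) → p , q , λ _ ()) (λ (p , q , _) → p , q) (isPerm? σ ×-dec isDumont? σ)))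
    (⟦⟧-cong (λ (p , q , _) → p , q) (λ (p , q) → p , q , λ _ ()) (map′ _ _ (isPerm? σ ×-dec isDumont? σ)) (isPerm? σ ×-dec isDumont? σ))

genocchi-gandhi : ∀ M → + genocchi (suc M) ≡ gandhi M 1
genocchi-gandhi zero = refl
genocchi-gandhi (suc M) = begin
  + dumontCount (2 ℕ.* suc M)        ≡⟨ cong (λ m → + dumontCount m) (2*-double (suc M)) ⟩
  + dumontCount (double (suc M))     ≡⟨ dumontCount-pairs (suc M) ⟩
  pairs (λ k → + (k ℕ.!)) (suc M) 0  ≡⟨ pairs-zero _ 1 base M ⟩
  gandhi (M ℕ.+ 1) 1                 ≡⟨ cong (λ k → gandhi k 1) (ℕ.+-comm M 1) ⟩
  gandhi (suc M) 1                   ∎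
  where
  lemma : ∀ a f → a * (a * f) ≡ f * (a * a * ((+ 1 + a) - a))
  lemma = solve-∀
  base : ∀ r → + suc r * + (suc r ℕ.!) ≡ + (r ℕ.!) * gandhi 1 (suc r)
  base r = trans (cong (+ suc r *_) (pos-suc-! r)) (lemma (+ suc r) (+ (r ℕ.!)))

-- A cyclic analogue of the permanent

-- One element is taken out of the list and F also receives the remaining ones. Positions are used
-- instead of equality tests because nodes will contain functions.
∑sel : (A → List A → ℤ) → List A → ℤ
∑sel F [] = + 0
∑sel F (x ∷ xs) = F x xs + ∑sel (λ y r → F y (x ∷ r)) xs

∑sel-cong : ∀ (xs : List A) {F G : A → List A → ℤ} →
  (∀ x r → x ∷ r ↭ xs → F x r ≡ G x r) → ∑sel F xs ≡ ∑sel G xs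
∑sel-cong [] eq = refl
∑sel-cong (x ∷ xs) eq = cong₂ _+_ (eq x xs ↭.refl)
  (∑sel-cong xs (λ y r p → eq y (x ∷ r) (↭.trans (swap y x ↭.refl) (prep x p))))

∑sel-↭ : ∀ {xs ys : List A} (F : A → List A → ℤ) → (∀ x {r s} → r ↭ s → F x r ≡ F x s) →
  xs ↭ ys → ∑sel F xs ≡ ∑sel F ys
∑sel-↭ F resp ↭.refl = refl
∑sel-↭ F resp (prep x p) = cong₂ _+_ (resp x p) (∑sel-↭ _ (λ y q → resp y (prep x q)) p)
∑sel-↭ F resp (swap {xs} {ys} x y p) = begin
  F x (y ∷ xs) + (F y (x ∷ xs) + ∑sel (λ z r → F z (x ∷ y ∷ r)) xs)
    ≡⟨ cong₂ _+_ (resp x (prep y p)) (cong₂ _+_ (resp y (prep x p)) (trans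
         (∑sel-cong xs (λ z r _ → resp z (swap x y ↭.refl)))
         (∑sel-↭ (λ z r → F z (y ∷ x ∷ r)) (λ z q → resp z (prep y (prep x q))) p))) ⟩
  F x (y ∷ ys) + (F y (x ∷ ys) + ∑sel (λ z r → F z (y ∷ x ∷ r)) ys)
    ≡⟨ lemma (F x (y ∷ ys)) (F y (x ∷ ys)) _ ⟩
  F y (x ∷ ys) + (F x (y ∷ ys) + ∑sel (λ z r → F z (y ∷ x ∷ r)) ys) ∎
  where
  lemma : ∀ a b c → a + (b + c) ≡ b + (a + c)
  lemma = solve-∀
∑sel-↭ F resp (↭.trans p q) = trans (∑sel-↭ F resp p) (∑sel-↭ F resp q)

∑sel-+ : ∀ (xs : List A) F G → ∑sel (λ x r → F x r + G x r) xs ≡ ∑sel F xs + ∑sel G xs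
∑sel-+ [] F G = refl
∑sel-+ (x ∷ xs) F G = trans (+-congˡ (F x xs + G x xs) (∑sel-+ xs _ _)) (lemma (F x xs) (G x xs) _ _)
  where
  lemma : ∀ a b c d → (a + b) + (c + d) ≡ (a + c) + (b + d)
  lemma = solve-∀

∑sel-- : ∀ (xs : List A) F G → ∑sel (λ x r → F x r - G x r) xs ≡ ∑sel F xs - ∑sel G xs
∑sel-- [] F G = refl
∑sel-- (x ∷ xs) F G = trans (+-congˡ (F x xs - G x xs) (∑sel-- xs _ _)) (lemma (F x xs) (G x xs) _ _)
  where
  lemma : ∀ a b c d → (a - b) + (c - d) ≡ (a + c) - (b + d)
  lemma = solve-∀

∑sel-*ˡ : ∀ c (xs : List A) F → ∑sel (λ x r → c * F x r) xs ≡ c * ∑sel F xs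
∑sel-*ˡ c [] F = sym (ℤ.*-zeroʳ c)
∑sel-*ˡ c (x ∷ xs) F = trans (+-congˡ (c * F x xs) (∑sel-*ˡ c xs _)) (sym (ℤ.*-distribˡ-+ c (F x xs) _))

∑sel-const : ∀ (xs : List A) c → ∑sel (λ _ _ → c) xs ≡ + length xs * c
∑sel-const [] c = refl
∑sel-const (x ∷ xs) c = trans (+-congˡ c (∑sel-const xs c)) (lemma c (+ length xs))
  where
  lemma : ∀ c l → c + l * c ≡ (+ 1 + l) * c
  lemma = solve-∀

∑sel-++-zero : ∀ (xs ys : List A) F → (∀ {x} → x ∈ xs → ∀ r → F x r ≡ + 0) →
  ∑sel F (xs ++ ys) ≡ ∑sel (λ y r → F y (xs ++ r)) ys
∑sel-++-zero [] ys F zeros = refl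
∑sel-++-zero (x ∷ xs) ys F zeros = trans (cong₂ _+_ (zeros (here refl) (xs ++ ys))
  (∑sel-++-zero xs ys _ (λ x∈ r → zeros (there x∈) _))) (ℤ.+-identityˡ _)

∑sel-swap : ∀ (xs : List A) (F : A → A → List A → ℤ) →
  ∑sel (λ x r → ∑sel (F x) r) xs ≡ ∑sel (λ x r → ∑sel (λ y → F y x) r) xs
∑sel-swap [] F = refl
∑sel-swap (x ∷ xs) F = begin
  ∑sel (F x) xs + ∑sel (λ y r → F y x r + ∑sel (λ z r′ → F y z (x ∷ r′)) r) xs
    ≡⟨ +-congˡ (∑sel (F x) xs) (∑sel-+ xs _ _) ⟩
  ∑sel (F x) xs + (∑sel (λ y → F y x) xs + ∑sel (λ y r → ∑sel (λ z r′ → F y z (x ∷ r′)) r) xs)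
    ≡⟨ cong (λ s → ∑sel (F x) xs + (∑sel (λ y → F y x) xs + s)) (∑sel-swap xs (λ y z r → F y z (x ∷ r))) ⟩
  ∑sel (F x) xs + (∑sel (λ y → F y x) xs + ∑sel (λ y r → ∑sel (λ z r′ → F z y (x ∷ r′)) r) xs)
    ≡⟨ lemma (∑sel (F x) xs) (∑sel (λ y → F y x) xs) _ ⟩
  ∑sel (λ y → F y x) xs + (∑sel (F x) xs + ∑sel (λ y r → ∑sel (λ z r′ → F z y (x ∷ r′)) r) xs)
    ≡⟨ +-congˡ (∑sel (λ y → F y x) xs) (∑sel-+ xs _ _) ⟨
  ∑sel (λ y → F y x) xs + ∑sel (λ y r → F x y r + ∑sel (λ z r′ → F z y (x ∷ r′)) r) xs ∎
  where
  lemma : ∀ a b c → a + (b + c) ≡ b + (a + c)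
  lemma = solve-∀

-- A node stands for a path that is already built: its first element, and the
-- weights of the possible continuations of its last element.
Node : Set
Node = ℕ × (ℕ → ℤ)

-- The weighted number of ways to close all paths into a single cycle, starting
-- from a given path; the first argument is the number of the other paths.
ham : ℕ → Node → List Node → ℤ
ham zero (s , w) _ = w s
ham (suc n) (s , w) rest = ∑sel (λ (s′ , w′) r → w s′ * ham n (s , w′) r) rest

ham-↭ : ∀ n x {xs ys} → xs ↭ ys → ham n x xs ≡ ham n x ys
ham-↭ zero x p = refl
ham-↭ (suc n) (s , w) p = ∑sel-↭ _ (λ (s′ , w′) q → cong (w s′ *_) (ham-↭ n (s , w′) q)) p

HamRotates : ℕ → Set
HamRotates n = ∀ x y r → suc (length r) ≡ n → ham n x (y ∷ r) ≡ ham n y (x ∷ r)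

-- A cycle may be read from any of its paths. The successors of x and y are split off: either x
-- leads to y and y to a third path, or y leads to x and x to a third path, or both lead to
-- different third paths. The first two cases are exchanged with x and y, the last one is symmetric
-- by induction.
ham-rotate-step : ∀ n → HamRotates (suc n) → HamRotates n → HamRotates (suc (suc n))
ham-rotate-step n rotate₁ rotate₀ x y r eq = begin
  ham (suc (suc n)) x (y ∷ r)                          ≡⟨ expand x y ⟩
  through x y + (through y x + apart x y)              ≡⟨ lemma (through x y) (through y x) (apart x y) ⟩
  through y x + (through x y + apart x y)              ≡⟨ cong (λ a → through y x + (through x y + a)) apart-sym ⟩
  through y x + (through x y + apart y x)              ≡⟨ expand y x ⟨
  ham (suc (suc n)) y (x ∷ r)                          ∎
  where
  lemma : ∀ a b c → a + (b + c) ≡ b + (a + c)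
  lemma = solve-∀
  *-left-comm : ∀ a b c → a * (b * c) ≡ b * (a * c)
  *-left-comm = solve-∀

  through : Node → Node → ℤ
  through (s₁ , w₁) (s₂ , w₂) = ∑sel (λ (s , w) r → w₁ s₂ * (w₂ s * ham n (s₁ , w) r)) r

  apart : Node → Node → ℤ
  apart (s₁ , w₁) (s₂ , w₂) =
    ∑sel (λ (s , w) r → ∑sel (λ (s′ , w′) r → w₁ s * (w₂ s′ * ham n (s₂ , w′) ((s₁ , w) ∷ r))) r) r

  expand : ∀ x y → ham (suc (suc n)) x (y ∷ r) ≡ through x y + (through y x + apart x y)
  expand (s₁ , w₁) (s₂ , w₂) = cong₂ _+_ (sym (∑sel-*ˡ (w₁ s₂) r _)) (trans
    (∑sel-cong r λ (s , w) r′ p → begin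
      w₁ s * ham (suc n) (s₁ , w) ((s₂ , w₂) ∷ r′)
        ≡⟨ cong (w₁ s *_) (rotate₁ (s₁ , w) (s₂ , w₂) r′ (trans (↭-length p) (ℕ.suc-injective eq))) ⟩
      w₁ s * (w₂ s₁ * ham n (s₂ , w) r′ + ∑sel (λ (s′ , w′) r → w₂ s′ * ham n (s₂ , w′) ((s₁ , w) ∷ r)) r′)
        ≡⟨ ℤ.*-distribˡ-+ (w₁ s) _ _ ⟩
      w₁ s * (w₂ s₁ * ham n (s₂ , w) r′) + w₁ s * ∑sel (λ (s′ , w′) r → w₂ s′ * ham n (s₂ , w′) ((s₁ , w) ∷ r)) r′
        ≡⟨ cong₂ _+_ (*-left-comm (w₁ s) (w₂ s₁) _) (sym (∑sel-*ˡ (w₁ s) r′ _)) ⟩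
      w₂ s₁ * (w₁ s * ham n (s₂ , w) r′) + ∑sel (λ (s′ , w′) r → w₁ s * (w₂ s′ * ham n (s₂ , w′) ((s₁ , w) ∷ r))) r′ ∎)
    (∑sel-+ r (λ (s , w) r → w₂ s₁ * (w₁ s * ham n (s₂ , w) r))
      (λ (s , w) r → ∑sel (λ (s′ , w′) r → w₁ s * (w₂ s′ * ham n (s₂ , w′) ((s₁ , w) ∷ r))) r)))

  apart-sym : apart x y ≡ apart y x
  apart-sym = trans (∑sel-swap r _) (∑sel-cong r λ (s , w) r′ p → ∑sel-cong r′ λ (s′ , w′) r″ q →
    trans (*-left-comm (proj₂ x s′) (proj₂ y s) _)
      (cong (λ h → proj₂ y s * (proj₂ x s′ * h))
        (rotate₀ (proj₁ y , w) (proj₁ x , w′) r″ (trans (↭-length q) (ℕ.suc-injective (trans (↭-length p) (ℕ.suc-injective eq)))))))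

ham-rotate : ∀ n → HamRotates n
ham-rotate (suc zero) (s₁ , w₁) (s₂ , w₂) [] eq = lemma (w₁ s₂) (w₂ s₁)
  where
  lemma : ∀ a b → a * b + + 0 ≡ b * a + + 0
  lemma = solve-∀
ham-rotate (suc (suc n)) = ham-rotate-step n (ham-rotate (suc n)) (ham-rotate n)

-- By rotation the choice of the head as starting path has no influence. The value at the empty list
-- is chosen to agree with `cycleBase 0`.
cyc : List Node → ℤ
cyc [] = + 1
cyc (x ∷ xs) = ham (length xs) x xs

cyc-↭ : ∀ {xs ys} → xs ↭ ys → cyc xs ≡ cyc ys
cyc-↭ ↭.refl = refl
cyc-↭ (prep {xs} x p) = trans (ham-↭ (length xs) x p) (cong (λ n → ham n x _) (↭-length p))
cyc-↭ (swap {xs} {ys} x y p) = trans (ham-rotate (suc (length xs)) x y xs refl)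
  (trans (ham-↭ (suc (length xs)) y (prep x p)) (cong (λ n → ham (suc n) y (x ∷ ys)) (↭-length p)))
cyc-↭ (↭.trans p q) = trans (cyc-↭ p) (cyc-↭ q)

cyc-expand : ∀ s w y ys →
  cyc ((s , w) ∷ y ∷ ys) ≡ ∑sel (λ (s′ , w′) r → w s′ * cyc ((s , w′) ∷ r)) (y ∷ ys)
cyc-expand s w y ys = ∑sel-cong (y ∷ ys) λ (s′ , w′) r p →
  cong (λ n → w s′ * ham n (s , w′) r) (sym (ℕ.suc-injective (↭-length p)))

cyc-head-cong : ∀ s {w w′ : ℕ → ℤ} → (∀ a → w a ≡ w′ a) → ∀ xs → cyc ((s , w) ∷ xs) ≡ cyc ((s , w′) ∷ xs)
cyc-head-cong s eq [] = eq s
cyc-head-cong s {w} {w′} eq (y ∷ ys) = ∑sel-cong (y ∷ ys) λ (s″ , u) r _ → cong (_* ham (length ys) (s , u) r) (eq s″)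

cyc-head-- : ∀ s w w′ xs → cyc ((s , λ a → w a - w′ a) ∷ xs) ≡ cyc ((s , w) ∷ xs) - cyc ((s , w′) ∷ xs)
cyc-head-- s w w′ [] = refl
cyc-head-- s w w′ (y ∷ ys) = trans
  (∑sel-cong (y ∷ ys) λ (s′ , u) r _ → lemma (w s′) (w′ s′) (ham (length ys) (s , u) r))
  (∑sel-- (y ∷ ys) (λ (s′ , u) r → w s′ * ham (length ys) (s , u) r) (λ (s′ , u) r → w′ s′ * ham (length ys) (s , u) r))
  where
  lemma : ∀ a b c → (a - b) * c ≡ a * c - b * c
  lemma = solve-∀

-- As another path remains, closing up the current path is not among the choices. The weights leave
-- exactly the paths in ys as possible continuations, and each of them leads to the same value K.
cyc-select : ∀ s w xs ys K → 0 < length (xs ++ ys) →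
  (∀ {x} → x ∈ xs → w (proj₁ x) ≡ + 0) → (∀ {y} → y ∈ ys → w (proj₁ y) ≡ + 1) →
  (∀ s′ w′ r → (s′ , w′) ∷ r ↭ ys → cyc ((s , w′) ∷ xs ++ r) ≡ K) →
  cyc ((s , w) ∷ xs ++ ys) ≡ + length ys * K
cyc-select s w xs ys K nonempty zeros ones const = begin
  cyc ((s , w) ∷ xs ++ ys)
    ≡⟨ expand (xs ++ ys) nonempty ⟩
  ∑sel F (xs ++ ys)
    ≡⟨ ∑sel-++-zero xs ys F (λ { {x} x∈ r → cong (_* cyc ((s , proj₂ x) ∷ r)) (zeros x∈) }) ⟩
  ∑sel (λ x r → F x (xs ++ r)) ys
    ≡⟨ ∑sel-cong ys (λ (s′ , w′) r p → trans (cong₂ _*_ (ones (∈-resp-↭ p (here refl))) (const s′ w′ r p)) (ℤ.*-identityˡ K)) ⟩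
  ∑sel (λ _ _ → K) ys
    ≡⟨ ∑sel-const ys K ⟩
  + length ys * K ∎
  where
  F : Node → List Node → ℤ
  F (s′ , w′) r = w s′ * cyc ((s , w′) ∷ r)
  expand : ∀ zs → 0 < length zs → cyc ((s , w) ∷ zs) ≡ ∑sel F zs
  expand (z ∷ zs) _ = cyc-expand s w z zs

-- D-permutations

DPair : ℕ → ℕ → Set
DPair t a = (suc t % 2 ≡ 1 → suc t ≤ suc a) × (suc t % 2 ≡ 0 → suc a ≤ suc t)

dPair? : ∀ t a → Dec (DPair t a)
dPair? t a = ((suc t % 2 ℕ.≟ 1) →-dec (suc t ℕ.≤? suc a)) ×-dec ((suc t % 2 ℕ.≟ 0) →-dec (suc a ℕ.≤? suc t))

dRow : ℕ → ℕ → ℤ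
dRow t a = ⟦ dPair? t a ⟧

dRow-odd : ∀ s a → dRow (double s) a ≡ + 1 - ⟦ a ℕ.<? double s ⟧
dRow-odd s a = trans (⟦⟧-cong
  (λ (o , _) a<t → ℕ.<⇒≱ a<t (ℕ.≤-pred (o (odd-position s))))
  (λ a≮t → (λ _ → s≤s (ℕ.≮⇒≥ a≮t)) , λ e → contradiction (trans (sym e) (odd-position s)) λ ())
  (dPair? (double s) a) (¬? (a ℕ.<? double s))) (⟦⟧-¬ (a ℕ.<? double s))

dRow-even : ∀ s a → dRow (suc (double s)) a ≡ ⟦ a ℕ.≤? suc (double s) ⟧
dRow-even s a = ⟦⟧-cong (λ (_ , e) → ℕ.≤-pred (e (even-position s)))
  (λ a≤t → (λ o → contradiction (trans (sym o) (even-position s)) λ ()) , λ _ → s≤s a≤t)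
  (dPair? (suc (double s)) a) (a ℕ.≤? suc (double s))

nodesFrom : (ℕ → ℕ → ℤ) → ℕ → ℕ → List Node
nodesFrom ρ t zero = []
nodesFrom ρ t (suc l) = (t , ρ t) ∷ nodesFrom ρ (suc t) l

nodesFrom-≥ : ∀ ρ t l {x} → x ∈ nodesFrom ρ t l → t ≤ proj₁ x
nodesFrom-≥ ρ t (suc l) (here refl) = ℕ.≤-refl
nodesFrom-≥ ρ t (suc l) (there x∈) = ℕ.<⇒≤ (nodesFrom-≥ ρ (suc t) l x∈)

-- A deferred node: a path starting below t whose end has not been continued.
Deferred : ℕ → Node → Set
Deferred t (s , w) = s < t × (w ≡ λ _ → + 1)

All-↭-head : ∀ {t x r ys} → x ∷ r ↭ ys → All (Deferred t) ys → Deferred t x × All (Deferred t) r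
All-↭-head p d with All-resp-↭ (↭.↭-sym p) d
  where open import Data.List.Relation.Binary.Permutation.Propositional.Properties using (All-resp-↭)
... | dx ∷ dr = dx , dr

-- The number of cyclic orders of r paths, where truncated subtraction gives 1 at r = 0.
cycleBase : ℕ → ℤ
cycleBase r = + ((r ∸ 1) ℕ.!)

cyc-deferred : ∀ r {t xs} → length xs ≡ r → All (Deferred t) xs → cyc xs ≡ cycleBase r
cyc-deferred zero {xs = []} eq _ = refl
cyc-deferred (suc zero) {xs = _ ∷ []} eq ((_ , refl) ∷ []) = refl
cyc-deferred (suc (suc r)) {t} {(s , _) ∷ xs} eq ((s<t , refl) ∷ d) = begin
  cyc ((s , (λ _ → + 1)) ∷ xs)
    ≡⟨ cyc-select s (λ _ → + 1) [] xs (cycleBase (suc r)) (ℕ.≤-trans (s≤s z≤n) (ℕ.≤-reflexive (sym (ℕ.suc-injective eq))))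
         (λ ()) (λ _ → refl) (const (cyc-deferred (suc r))) ⟩
  + length xs * cycleBase (suc r)
    ≡⟨ cong (λ k → + k * cycleBase (suc r)) (ℕ.suc-injective eq) ⟩
  + suc r * + (r ℕ.!)
    ≡⟨ pos-suc-! r ⟨
  cycleBase (suc (suc r)) ∎
  where
  const : (∀ {t ys} → length ys ≡ suc r → All (Deferred t) ys → cyc ys ≡ cycleBase (suc r)) →
    ∀ s′ w′ q → (s′ , w′) ∷ q ↭ xs → cyc ((s , w′) ∷ q) ≡ cycleBase (suc r)
  const ih s′ w′ q p with All-↭-head p d
  ... | (_ , w′≡) , dq = ih {t} (trans (↭-length p) (ℕ.suc-injective eq)) ((s<t , w′≡) ∷ dq)

-- As for Dumont permutations, odd rows are split as 1 - [a < t] and the all-ones rows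
-- deferred.  The rows that are not deferred only point downwards, so they never close a cycle.
cyc-D : ∀ M s r {xs} → length xs ≡ r → All (Deferred (double s)) xs →
  cyc (nodesFrom dRow (double s) (double M) ++ xs) ≡ pairs cycleBase M r
cyc-D zero s r eq d = cyc-deferred r eq d
cyc-D (suc M) s r {xs} eq d = begin
  cyc ((t , dRow t) ∷ (suc t , dRow (suc t)) ∷ future ++ xs)
    ≡⟨ cyc-head-cong t (dRow-odd s) ((suc t , dRow (suc t)) ∷ future ++ xs) ⟩
  cyc ((t , λ a → + 1 - ⟦ a ℕ.<? t ⟧) ∷ (suc t , dRow (suc t)) ∷ future ++ xs)
    ≡⟨ cyc-head-- t (λ _ → + 1) (λ a → ⟦ a ℕ.<? t ⟧) ((suc t , dRow (suc t)) ∷ future ++ xs) ⟩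
  cyc ((t , λ _ → + 1) ∷ (suc t , dRow (suc t)) ∷ future ++ xs)
    - cyc ((t , λ a → ⟦ a ℕ.<? t ⟧) ∷ (suc t , dRow (suc t)) ∷ future ++ xs)
    ≡⟨ cong₂ _-_ deferred constrained ⟩
  + suc r * pairs cycleBase M (suc r) - + r * (+ r * pairs cycleBase M r) ∎
  where
  t = double s
  future = nodesFrom dRow (suc (suc t)) (double M)

  widen : ∀ {t ys} → All (Deferred t) ys → All (Deferred (suc t)) ys
  widen = All.map (λ (s< , w≡) → ℕ.m≤n⇒m≤1+n s< , w≡)

  even : ∀ r {ys} → length ys ≡ suc r → All (Deferred (suc t)) ys →
    cyc ((suc t , dRow (suc t)) ∷ future ++ ys) ≡ + suc r * pairs cycleBase M (suc r)
  even r {ys} eq d = begin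
    cyc ((suc t , dRow (suc t)) ∷ future ++ ys)
      ≡⟨ cyc-head-cong (suc t) (dRow-even s) (future ++ ys) ⟩
    cyc ((suc t , λ a → ⟦ a ℕ.≤? suc t ⟧) ∷ future ++ ys)
      ≡⟨ cyc-select (suc t) _ future ys (pairs cycleBase M (suc r))
           (ℕ.≤-trans (ℕ.≤-trans (s≤s z≤n) (ℕ.≤-reflexive (sym eq)))
             (ℕ.≤-trans (ℕ.m≤n+m (length ys) (length future)) (ℕ.≤-reflexive (sym (List.length-++ future)))))
           (λ {x} x∈ → ⟦⟧-no (λ x≤ → ℕ.<⇒≱ (nodesFrom-≥ dRow (suc (suc t)) (double M) x∈) x≤) (proj₁ x ℕ.≤? suc t))
           (λ {y} y∈ → ⟦⟧-yes (ℕ.<⇒≤ (proj₁ (All.lookup d y∈))) (proj₁ y ℕ.≤? suc t))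
           const ⟩
    + length ys * pairs cycleBase M (suc r)
      ≡⟨ cong (λ k → + k * pairs cycleBase M (suc r)) eq ⟩
    + suc r * pairs cycleBase M (suc r) ∎
    where
    const : ∀ s′ w′ q → (s′ , w′) ∷ q ↭ ys → cyc ((suc t , w′) ∷ future ++ q) ≡ pairs cycleBase M (suc r)
    const s′ w′ q p with All-↭-head p d
    -- The extended path inherits the unconstrained end of the deferred path that it absorbs. It is
    -- thus deferred itself, and the number of deferred paths is restored.
    ... | (_ , w′≡) , dq = trans (cyc-↭ (↭.↭-sym (shift (suc t , w′) future q)))
      (cyc-D M (suc s) (suc r) (trans (↭-length p) eq) ((ℕ.≤-refl , w′≡) ∷ widen dq))

  deferred : cyc ((t , λ _ → + 1) ∷ (suc t , dRow (suc t)) ∷ future ++ xs) ≡ + suc r * pairs cycleBase M (suc r)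
  deferred = trans (cyc-↭ (↭.↭-sym (shift (t , λ _ → + 1) ((suc t , dRow (suc t)) ∷ future) xs)))
    (even r (cong suc eq) ((ℕ.≤-refl , refl) ∷ widen d))

  constrained : cyc ((t , λ a → ⟦ a ℕ.<? t ⟧) ∷ (suc t , dRow (suc t)) ∷ future ++ xs) ≡ + r * (+ r * pairs cycleBase M r)
  constrained = trans
    (cyc-select t _ ((suc t , dRow (suc t)) ∷ future) xs (+ r * pairs cycleBase M r) (s≤s z≤n)
      (λ {x} x∈ → ⟦⟧-no (λ x< → ℕ.<-asym x< (nodesFrom-≥ dRow (suc t) (suc (double M)) x∈)) (proj₁ x ℕ.<? t))
      (λ {y} y∈ → ⟦⟧-yes (proj₁ (All.lookup d y∈)) (proj₁ y ℕ.<? t))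
      const)
    (cong (λ k → + k * (+ r * pairs cycleBase M r)) eq)
    where
    const : ∀ s′ w′ q → (s′ , w′) ∷ q ↭ xs →
      cyc ((t , w′) ∷ (suc t , dRow (suc t)) ∷ future ++ q) ≡ + r * pairs cycleBase M r
    const s′ w′ q p with All-↭-head p d
    ... | (_ , w′≡) , dq = begin
      cyc ((t , w′) ∷ (suc t , dRow (suc t)) ∷ future ++ q)
        ≡⟨ cyc-↭ (↭.↭-sym (shift (t , w′) ((suc t , dRow (suc t)) ∷ future) q)) ⟩
      cyc ((suc t , dRow (suc t)) ∷ future ++ (t , w′) ∷ q)
        ≡⟨ even (length q) refl ((ℕ.≤-refl , w′≡) ∷ widen dq) ⟩
      + suc (length q) * pairs cycleBase M (suc (length q))
        ≡⟨ cong (λ k → + k * pairs cycleBase M k) (trans (↭-length p) eq) ⟩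
      + r * pairs cycleBase M r ∎

-- Recognising single cycles

-- In contrast to `weight`, no used columns are recorded: injectivity will come from `cycIndicator`.
product : ∀ {m l} → Vec (ℕ → ℤ) l → Vec (Fin m) l → ℤ
product [] [] = + 1
product (w ∷ ws) (a ∷ v) = w (toℕ a) * product ws v

product-indicator : ∀ {m l} {C : Fin l → ℕ → Set} (C? : ∀ i a → Dec (C i a)) (ws : Vec (ℕ → ℤ) l) →
  (∀ i a → lookup ws i a ≡ ⟦ C? i a ⟧) → (v : Vec (Fin m) l) → (d : Dec (∀ i → C i (toℕ (lookup v i)))) →
  product ws v ≡ ⟦ d ⟧
product-indicator C? [] eq [] d = sym (⟦⟧-yes (λ ()) d)
product-indicator C? (w ∷ ws) eq (a ∷ v) d rewrite eq zero (toℕ a) with C? zero (toℕ a)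
... | no ¬c = sym (⟦⟧-no (λ c → ¬c (c zero)) d)
... | yes c = trans (ℤ.*-identityˡ _) (trans
  (product-indicator (C? ∘ suc) ws (eq ∘ suc) v (map′ (_∘ suc) (λ { cs zero → c ; cs (suc i) → cs i }) d))
  (⟦⟧-cong (λ { cs zero → c ; cs (suc i) → cs i }) (_∘ suc) (map′ _ _ d) d))

module _ {m : ℕ} where

  -- The entries of st are the first elements of the paths, and v holds the images of their
  -- last elements.  The first path is extended by the path that its image starts.
  cycIndicator : ∀ {l} (st v : Vec (Fin m) (suc l)) → ℤ
  cycIndicator {zero} (s ∷ []) (a ∷ []) = ⟦ a Fin.≟ s ⟧
  cycIndicator {suc l} (s ∷ st) (a ∷ v) =
    ∑ (allFin (suc l)) (λ j → ⟦ a Fin.≟ lookup st j ⟧ * cycIndicator (st Vec.[ j ]≔ s) v)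

  nodes : ∀ {l} → Vec (Fin m) l → Vec (ℕ → ℤ) l → List Node
  nodes [] [] = []
  nodes (s ∷ st) (w ∷ ws) = (toℕ s , w) ∷ nodes st ws

  -- Joining path j to the current one gives a path with start s and the end of path j. It stands at
  -- the front of the list but in slot j of the vector, hence the invariance required of H.
  ∑sel-nodes : ∀ {l} (H : ℕ → List Node → ℤ) → (∀ s {r r′} → r ↭ r′ → H s r ≡ H s r′) →
    ∀ (st : Vec (Fin m) l) ws s →
    ∑sel (λ (s′ , w′) r → H s′ ((toℕ s , w′) ∷ r)) (nodes st ws)
      ≡ ∑ (allFin l) (λ j → H (toℕ (lookup st j)) (nodes (st Vec.[ j ]≔ s) ws))
  ∑sel-nodes H resp [] [] s = refl
  ∑sel-nodes {suc l} H resp (x ∷ st) (w ∷ ws) s = begin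
    H (toℕ x) ((toℕ s , w) ∷ nodes st ws) + ∑sel (λ (s′ , w′) r → H s′ ((toℕ s , w′) ∷ (toℕ x , w) ∷ r)) (nodes st ws)
      ≡⟨ +-congˡ (H (toℕ x) ((toℕ s , w) ∷ nodes st ws)) (begin
           ∑sel (λ (s′ , w′) r → H s′ ((toℕ s , w′) ∷ (toℕ x , w) ∷ r)) (nodes st ws)
             ≡⟨ ∑sel-cong (nodes st ws) (λ (s′ , w′) r _ → resp s′ (swap _ _ ↭.refl)) ⟩
           ∑sel (λ (s′ , w′) r → H s′ ((toℕ x , w) ∷ (toℕ s , w′) ∷ r)) (nodes st ws)
             ≡⟨ ∑sel-nodes (λ s′ r → H s′ ((toℕ x , w) ∷ r)) (λ s′ p → resp s′ (prep _ p)) st ws s ⟩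
           ∑ (allFin l) (λ j → H (toℕ (lookup st j)) ((toℕ x , w) ∷ nodes (st Vec.[ j ]≔ s) ws)) ∎) ⟩
    H (toℕ x) ((toℕ s , w) ∷ nodes st ws) + ∑ (allFin l) (λ j → H (toℕ (lookup st j)) ((toℕ x , w) ∷ nodes (st Vec.[ j ]≔ s) ws))
      ≡⟨ ∑-tabulate-suc l (λ j → H (toℕ (lookup (x ∷ st) j)) (nodes ((x ∷ st) Vec.[ j ]≔ s) (w ∷ ws))) ⟨
    ∑ (allFin (suc l)) (λ j → H (toℕ (lookup (x ∷ st) j)) (nodes ((x ∷ st) Vec.[ j ]≔ s) (w ∷ ws))) ∎

  ∑-allVecs-suc : ∀ l (f : Vec (Fin m) (suc l) → ℤ) →
    ∑ (allVecs m (suc l)) f ≡ ∑ (allFin m) (λ a → ∑ (allVecs m l) (λ v → f (a ∷ v)))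
  ∑-allVecs-suc l f = trans (∑-concatMap _ (allFin m) f) (∑-cong (allFin m) (λ a → ∑-map (a ∷_) (allVecs m l) f))

  ∑-pick-≡ : ∀ b (f : Fin m → ℤ) → ∑ (allFin m) (λ a → ⟦ a Fin.≟ b ⟧ * f a) ≡ f b
  ∑-pick-≡ b f = ∑-pick Fin._≟_ (Unique.allFin⁺ m) (∈-allFin b) f

  ∑-cycIndicator : ∀ {l} (st : Vec (Fin m) (suc l)) ws →
    ∑ (allVecs m (suc l)) (λ v → product ws v * cycIndicator st v) ≡ cyc (nodes st ws)
  ∑-cycIndicator {zero} (s ∷ []) (w ∷ []) = begin
    ∑ (allVecs m 1) (λ v → product (w ∷ []) v * cycIndicator (s ∷ []) v)
      ≡⟨ ∑-allVecs-suc 0 _ ⟩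
    ∑ (allFin m) (λ a → w (toℕ a) * + 1 * ⟦ a Fin.≟ s ⟧ + + 0)
      ≡⟨ ∑-cong (allFin m) (λ a → lemma (w (toℕ a)) ⟦ a Fin.≟ s ⟧) ⟩
    ∑ (allFin m) (λ a → ⟦ a Fin.≟ s ⟧ * w (toℕ a))
      ≡⟨ ∑-pick-≡ s (w ∘ toℕ) ⟩
    w (toℕ s) ∎
    where
    lemma : ∀ x y → x * + 1 * y + + 0 ≡ y * x
    lemma = solve-∀
  ∑-cycIndicator {suc l} (s ∷ st@(y ∷ st₁)) (w ∷ ws@(w₁ ∷ ws₁)) = begin
    ∑ (allVecs m (suc (suc l))) (λ v → product (w ∷ ws) v * cycIndicator (s ∷ st) v)
      ≡⟨ ∑-allVecs-suc (suc l) _ ⟩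
    ∑ (allFin m) (λ a → ∑ vs (λ v → w (toℕ a) * product ws v * ∑ js (λ j → ⟦ a Fin.≟ lookup st j ⟧ * c j v)))
      ≡⟨ ∑-cong (allFin m) inner ⟩
    ∑ (allFin m) (λ a → ∑ js (λ j → ⟦ a Fin.≟ lookup st j ⟧ * (w (toℕ a) * K j)))
      ≡⟨ ∑-swap (allFin m) js _ ⟩
    ∑ js (λ j → ∑ (allFin m) (λ a → ⟦ a Fin.≟ lookup st j ⟧ * (w (toℕ a) * K j)))
      ≡⟨ ∑-cong js (λ j → ∑-pick-≡ (lookup st j) (λ a → w (toℕ a) * K j)) ⟩
    ∑ js (λ j → w (toℕ (lookup st j)) * K j)
      ≡⟨ ∑sel-nodes (λ s′ r → w s′ * cyc r) (λ s′ p → cong (w s′ *_) (cyc-↭ p)) st ws s ⟨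
    ∑sel (λ (s′ , w′) r → w s′ * cyc ((toℕ s , w′) ∷ r)) (nodes st ws)
      ≡⟨ cyc-expand (toℕ s) w (toℕ y , w₁) (nodes st₁ ws₁) ⟨
    cyc (nodes (s ∷ st) (w ∷ ws)) ∎
    where
    vs = allVecs m (suc l)
    js = allFin (suc l)
    c : Fin (suc l) → Vec (Fin m) (suc l) → ℤ
    c j v = cycIndicator (st Vec.[ j ]≔ s) v
    K : Fin (suc l) → ℤ
    K j = cyc (nodes (st Vec.[ j ]≔ s) ws)
    lemma : ∀ x p i c → x * p * (i * c) ≡ i * x * (p * c)
    lemma = solve-∀
    inner : ∀ a → ∑ vs (λ v → w (toℕ a) * product ws v * ∑ js (λ j → ⟦ a Fin.≟ lookup st j ⟧ * c j v))
      ≡ ∑ js (λ j → ⟦ a Fin.≟ lookup st j ⟧ * (w (toℕ a) * K j))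
    inner a = begin
      ∑ vs (λ v → w (toℕ a) * product ws v * ∑ js (λ j → ⟦ a Fin.≟ lookup st j ⟧ * c j v))
        ≡⟨ ∑-cong vs (λ v → sym (∑-*ˡ (w (toℕ a) * product ws v) js _)) ⟩
      ∑ vs (λ v → ∑ js (λ j → w (toℕ a) * product ws v * (⟦ a Fin.≟ lookup st j ⟧ * c j v)))
        ≡⟨ ∑-swap vs js _ ⟩
      ∑ js (λ j → ∑ vs (λ v → w (toℕ a) * product ws v * (⟦ a Fin.≟ lookup st j ⟧ * c j v)))
        ≡⟨ ∑-cong js (λ j → begin
             ∑ vs (λ v → w (toℕ a) * product ws v * (⟦ a Fin.≟ lookup st j ⟧ * c j v))
               ≡⟨ ∑-cong vs (λ v → lemma (w (toℕ a)) (product ws v) ⟦ a Fin.≟ lookup st j ⟧ (c j v)) ⟩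
             ∑ vs (λ v → ⟦ a Fin.≟ lookup st j ⟧ * w (toℕ a) * (product ws v * c j v))
               ≡⟨ ∑-*ˡ (⟦ a Fin.≟ lookup st j ⟧ * w (toℕ a)) vs _ ⟩
             ⟦ a Fin.≟ lookup st j ⟧ * w (toℕ a) * ∑ vs (λ v → product ws v * c j v)
               ≡⟨ cong (⟦ a Fin.≟ lookup st j ⟧ * w (toℕ a) *_) (∑-cycIndicator (st Vec.[ j ]≔ s) ws) ⟩
             ⟦ a Fin.≟ lookup st j ⟧ * w (toℕ a) * K j
               ≡⟨ ℤ.*-assoc ⟦ a Fin.≟ lookup st j ⟧ (w (toℕ a)) (K j) ⟩
             ⟦ a Fin.≟ lookup st j ⟧ * (w (toℕ a) * K j) ∎) ⟩
      ∑ js (λ j → ⟦ a Fin.≟ lookup st j ⟧ * (w (toℕ a) * K j)) ∎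

  Edge : ∀ {l} (st v : Vec (Fin m) l) → Fin l → Fin l → Set
  Edge st v i j = lookup v i ≡ lookup st j

  -- The closure is not reflexive, so each path must also lead back to itself. For a single path
  -- this is exactly the closing condition.
  Connected : ∀ {l} (st v : Vec (Fin m) l) → Set
  Connected st v = ∀ i j → TransClosure (Edge st v) i j

  module Contraction {l} {s a : Fin m} {st v : Vec (Fin m) (suc l)} (st-inj : Injective (s ∷ st))
    (j : Fin (suc l)) (a≡ : a ≡ lookup st j) where

    st′ : Vec (Fin m) (suc l)
    st′ = st Vec.[ j ]≔ s

    s≢ : ∀ k → ¬ s ≡ lookup st k
    s≢ k = injective-head st-inj k ∘ sym

    updated : lookup st′ j ≡ s
    updated = Vec.lookup∘update j st s

    unchanged : ∀ {k} → ¬ k ≡ j → lookup st′ k ≡ lookup st k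
    unchanged k≢j = Vec.lookup∘update′ k≢j st s

    st′-injective : Injective st′
    st′-injective i k eq with i Fin.≟ j | k Fin.≟ j
    ... | yes refl | yes refl = refl
    ... | yes refl | no k≢j = contradiction (trans (sym updated) (trans eq (unchanged k≢j))) (s≢ k)
    ... | no i≢j | yes refl = contradiction (trans (sym updated) (trans (sym eq) (unchanged i≢j))) (s≢ i)
    ... | no i≢j | no k≢j = injective-tail st-inj i k (trans (sym (unchanged i≢j)) (trans eq (unchanged k≢j)))

    contract : Fin (suc (suc l)) → Fin (suc l)
    contract zero = j
    contract (suc k) = k

    module _ (inj : Injective (a ∷ v)) where

      contract-edge : ∀ {i y} → Edge (s ∷ st) (a ∷ v) (suc i) y → Edge st′ v i (contract y)
      contract-edge {i} {zero} e = trans e (sym updated)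
      contract-edge {i} {suc k} e with k Fin.≟ j
      ... | yes refl = contradiction (trans e (sym a≡)) (injective-head inj i)
      ... | no k≢j = trans e (sym (unchanged k≢j))

      contract-edge-zero : ∀ {y} → Edge (s ∷ st) (a ∷ v) zero y → y ≡ suc j
      contract-edge-zero {y} e = st-inj y (suc j) (trans (sym e) a≡)

      mutual
        contract-path : ∀ {i y} → TransClosure (Edge (s ∷ st) (a ∷ v)) (suc i) y → TransClosure (Edge st′ v) i (contract y)
        contract-path {i} {y} [ e ] = [ contract-edge {i} {y} e ]
        contract-path {i} (_∷_ {y = suc k} e p) = contract-edge {i} {suc k} e ∷ contract-path p
        contract-path {i} (_∷_ {y = zero} e p) with contract-path-zero p
        ... | inj₁ eq = subst (TransClosure (Edge st′ v) i) (sym eq) [ contract-edge {i} {zero} e ]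
        ... | inj₂ q = contract-edge {i} {zero} e ∷ q

        -- The step from `zero` to `suc j` disappears in the contraction. A walk consisting of this
        -- step alone has no image in the transitive closure, which explains the first alternative.
        contract-path-zero : ∀ {y} → TransClosure (Edge (s ∷ st) (a ∷ v)) zero y →
          contract y ≡ j ⊎ TransClosure (Edge st′ v) j (contract y)
        contract-path-zero {y} [ e ] = inj₁ (cong contract (contract-edge-zero {y} e))
        contract-path-zero (_∷_ {y = y} e p) with contract-edge-zero {y} e
        ... | refl = inj₂ (contract-path p)

    lift-edge : ∀ {i k} → Edge st′ v i k → TransClosure (Edge (s ∷ st) (a ∷ v)) (suc i) (suc k)
    lift-edge {i} {k} e with k Fin.≟ j
    ... | yes refl = _∷_ {y = zero} (trans e updated) [ a≡ ]
    ... | no k≢j = [ trans e (unchanged k≢j) ]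

    lift-path : ∀ {i k} → TransClosure (Edge st′ v) i k → TransClosure (Edge (s ∷ st) (a ∷ v)) (suc i) (suc k)
    lift-path {i} {k} [ e ] = lift-edge {i} {k} e
    lift-path {i} (_∷_ {y = y} e p) = lift-edge {i} {y} e ⁺++ lift-path p

    lift-path-zero : ∀ {i k} → k ≡ j → TransClosure (Edge st′ v) i k → TransClosure (Edge (s ∷ st) (a ∷ v)) (suc i) zero
    lift-path-zero refl [ e ] = [ trans e updated ]
    lift-path-zero {i} eq (_∷_ {y = y} e p) = lift-edge {i} {y} e ⁺++ lift-path-zero eq p

    contracted : Injective (a ∷ v) × Connected (s ∷ st) (a ∷ v) → Injective v × Connected st′ v
    contracted (inj , conn) = injective-tail inj , λ i k → contract-path inj (conn (suc i) (suc k))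

    lifted : Injective v × Connected st′ v → Injective (a ∷ v) × Connected (s ∷ st) (a ∷ v)
    lifted (inj , conn) = injective-∷ inj a∉v , conn′
      where
      image : ∀ {i k} → TransClosure (Edge st′ v) i k → ∃ λ k → lookup v i ≡ lookup st′ k
      image {k = k} [ e ] = k , e
      image (_∷_ {y = k} e p) = k , e

      -- Connectedness makes every entry of v the start of a contracted path, while a was the start
      -- of path j and is no longer a start after the update.
      a∉v : ∀ i → ¬ lookup v i ≡ a
      a∉v i v≡a with image (conn i i)
      ... | k , e with k Fin.≟ j
      ...   | yes refl = s≢ j (trans (sym updated) (trans (sym e) (trans v≡a a≡)))
      ...   | no k≢j = k≢j (injective-tail st-inj k j (trans (sym (unchanged k≢j)) (trans (sym e) (trans v≡a a≡))))

      conn′ : Connected (s ∷ st) (a ∷ v)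
      conn′ zero zero = _∷_ {y = suc j} a≡ (lift-path-zero refl (conn j j))
      conn′ zero (suc k) = _∷_ {y = suc j} a≡ (lift-path (conn j k))
      conn′ (suc i) zero = lift-path-zero refl (conn i j)
      conn′ (suc i) (suc k) = lift-path (conn i k)

  leaves-zero : ∀ {l s a k} {st v : Vec (Fin m) l} → TransClosure (Edge (s ∷ st) (a ∷ v)) zero (suc k) →
    ∃ λ j → a ≡ lookup st j
  leaves-zero {k = k} [ e ] = k , e
  leaves-zero (_∷_ {y = zero} e p) = leaves-zero p
  leaves-zero (_∷_ {y = suc j} e p) = j , e

  cycIndicator-correct : ∀ {l} (st v : Vec (Fin m) (suc l)) → Injective st →
    (d : Dec (Injective v × Connected st v)) → cycIndicator st v ≡ ⟦ d ⟧
  cycIndicator-correct {zero} (s ∷ []) (a ∷ []) st-inj d = ⟦⟧-cong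
    (λ a≡s → (λ { zero zero _ → refl }) , λ { zero zero → [ a≡s ] })
    (λ (_ , conn) → loop (conn zero zero)) (a Fin.≟ s) d
    where
    loop : TransClosure (Edge (s ∷ []) (a ∷ [])) zero zero → a ≡ s
    loop [ e ] = e
    loop (_∷_ {y = zero} e _) = e
  cycIndicator-correct {suc l} (s ∷ st) (a ∷ v) st-inj d with Fin.any? (λ j → a Fin.≟ lookup st j)
  ... | no ∄j = begin
    ∑ (allFin (suc l)) (λ j → ⟦ a Fin.≟ lookup st j ⟧ * cycIndicator (st Vec.[ j ]≔ s) v)
      ≡⟨ ∑-cong (allFin (suc l)) (λ j → cong (_* cycIndicator (st Vec.[ j ]≔ s) v) (⟦⟧-no (λ e → ∄j (j , e)) (a Fin.≟ lookup st j))) ⟩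
    ∑ (allFin (suc l)) (λ _ → + 0)
      ≡⟨ ∑-zero (allFin (suc l)) ⟩
    + 0
      ≡⟨ ⟦⟧-no (λ (_ , conn) → ∄j (leaves-zero (conn zero (suc zero)))) d ⟨
    ⟦ d ⟧ ∎
  ... | yes (j , a≡) = begin
    ∑ (allFin (suc l)) (λ k → ⟦ a Fin.≟ lookup st k ⟧ * cycIndicator (st Vec.[ k ]≔ s) v)
      ≡⟨ ∑-cong (allFin (suc l)) (λ k → cong (_* cycIndicator (st Vec.[ k ]≔ s) v)
           (⟦⟧-cong (λ e → injective-tail st-inj k j (trans (sym e) a≡)) (λ { refl → a≡ }) (a Fin.≟ lookup st k) (k Fin.≟ j))) ⟩
    ∑ (allFin (suc l)) (λ k → ⟦ k Fin.≟ j ⟧ * cycIndicator (st Vec.[ k ]≔ s) v)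
      ≡⟨ ∑-pick Fin._≟_ (Unique.allFin⁺ (suc l)) (∈-allFin j) (λ k → cycIndicator (st Vec.[ k ]≔ s) v) ⟩
    cycIndicator (st Vec.[ j ]≔ s) v
      ≡⟨ cycIndicator-correct (st Vec.[ j ]≔ s) v st′-injective (map′ contracted lifted d) ⟩
    ⟦ map′ contracted lifted d ⟧
      ≡⟨ ⟦⟧-cong lifted contracted (map′ contracted lifted d) d ⟩
    ⟦ d ⟧ ∎
    where open Contraction {v = v} st-inj j a≡

  -- Orbits of a permutation as walks

  module _ (σ : Vec (Fin m) m) where

    Step : Fin m → Fin m → Set
    Step = Edge (Vec.allFin m) σ

    step : ∀ i → Step i (lookup σ i)
    step i = sym (Vec.lookup-allFin (lookup σ i))

    iter-path : ∀ t i → TransClosure Step i (iter σ t (lookup σ i))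
    iter-path zero i = [ step i ]
    iter-path (suc t) i = iter-path t i ⁺++ [ step (iter σ t (lookup σ i)) ]

    iter-+ : ∀ t s i → iter σ t (iter σ s i) ≡ iter σ (t ℕ.+ s) i
    iter-+ zero s i = refl
    iter-+ (suc t) s i = cong (lookup σ) (iter-+ t s i)

    path-iter : ∀ {i j} → TransClosure Step i j → ∃ λ t → iter σ t i ≡ j
    path-iter {j = j} [ e ] = 1 , trans e (Vec.lookup-allFin j)
    path-iter {i} (_∷_ {y = y} e p) with path-iter p
    ... | t , eq = t ℕ.+ 1 , trans (sym (iter-+ t 1 i))
      (trans (cong (iter σ t) (trans e (Vec.lookup-allFin y))) eq)

    -- By the pigeonhole principle the orbit of i is exhausted after m steps.
    iter-bounded : ∀ i t → ∃ λ (t′ : Fin m) → iter σ (toℕ t′) i ≡ iter σ t i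
    iter-bounded i t with reduce t
      where
      reduce : ∀ t → ∃ λ t′ → t′ < m × iter σ t′ i ≡ iter σ t i
      reduce zero = 0 , ℕ.≤-<-trans z≤n (Fin.toℕ<n i) , refl
      reduce (suc t) with reduce t
      ... | t′ , t′<m , eq with ℕ.m≤n⇒m<n∨m≡n t′<m
      ...   | inj₁ lt = suc t′ , lt , cong (lookup σ) eq
      ...   | inj₂ refl with Fin.pigeonhole ℕ.≤-refl (λ (x : Fin (suc m)) → iter σ (toℕ x) i)
      ...     | x , y , x<y , fx≡fy = m ∸ toℕ y ℕ.+ toℕ x ,
        ℕ.<-≤-trans (ℕ.+-monoʳ-< (m ∸ toℕ y) x<y) (ℕ.≤-reflexive y+) ,
        (begin
          iter σ (m ∸ toℕ y ℕ.+ toℕ x) i        ≡⟨ iter-+ (m ∸ toℕ y) (toℕ x) i ⟨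
          iter σ (m ∸ toℕ y) (iter σ (toℕ x) i) ≡⟨ cong (iter σ (m ∸ toℕ y)) fx≡fy ⟩
          iter σ (m ∸ toℕ y) (iter σ (toℕ y) i) ≡⟨ iter-+ (m ∸ toℕ y) (toℕ y) i ⟩
          iter σ (m ∸ toℕ y ℕ.+ toℕ y) i        ≡⟨ cong (λ k → iter σ k i) y+ ⟩
          iter σ m i                            ≡⟨ cong (lookup σ) eq ⟩
          iter σ (suc t) i                      ∎)
        where
        y+ : m ∸ toℕ y ℕ.+ toℕ y ≡ m
        y+ = ℕ.m∸n+n≡m (ℕ.≤-pred (Fin.toℕ<n y))
    ... | t′ , t′<m , eq = Fin.fromℕ< t′<m , trans (cong (λ k → iter σ k i) (Fin.toℕ-fromℕ< t′<m)) eq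

    connected⇒singleCycle : Connected (Vec.allFin m) σ → SingleCycle σ
    connected⇒singleCycle conn i j with path-iter (conn i j)
    ... | t , eq with iter-bounded i t
    ...   | t′ , eq′ = t′ , trans eq′ eq

    singleCycle⇒connected : SingleCycle σ → Connected (Vec.allFin m) σ
    -- The orbit is entered at σ i since the exponent may be 0, whereas the transitive closure needs
    -- at least one step.
    singleCycle⇒connected cyclic i j with cyclic (lookup σ i) j
    ... | t , eq = subst (TransClosure Step i) eq (iter-path (toℕ t) i)

dCycleCount : ℕ → ℕ
dCycleCount m = length (filter (λ σ → isPerm? σ ×-dec (isD? σ ×-dec singleCycle? σ)) (allVecs m m))

dCycleCount-pairs : ∀ M → + dCycleCount (double (suc M)) ≡ pairs cycleBase (suc M) 0
dCycleCount-pairs M = begin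
  + dCycleCount m
    ≡⟨ length-filter-∑ _ (allVecs m m) ⟩
  ∑ (allVecs m m) (λ σ → ⟦ isPerm? σ ×-dec (isD? σ ×-dec singleCycle? σ) ⟧)
    ≡⟨ ∑-cong (allVecs m m) indicator ⟨
  ∑ (allVecs m m) (λ σ → product rows σ * cycIndicator starts σ)
    ≡⟨ ∑-cycIndicator starts rows ⟩
  cyc (nodes starts rows)
    ≡⟨ cong cyc (trans (sym (List.++-identityʳ _)) (cong (_++ []) (nodes-rows 0 m id (λ _ → refl)))) ⟩
  cyc (nodesFrom dRow 0 m ++ [])
    ≡⟨ cyc-D (suc M) 0 0 refl [] ⟩
  pairs cycleBase (suc M) 0 ∎
  where
  m = double (suc M)
  rows = rowsFrom dRow 0 m
  starts : Vec (Fin m) m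
  starts = Vec.allFin m

  nodes-rows : ∀ t l (f : Fin l → Fin m) → (∀ i → toℕ (f i) ≡ t ℕ.+ toℕ i) →
    nodes (Vec.tabulate f) (rowsFrom dRow t l) ≡ nodesFrom dRow t l
  nodes-rows t zero f eq = refl
  nodes-rows t (suc l) f eq = cong₂ _∷_ (cong (_, dRow t) (trans (eq zero) (ℕ.+-identityʳ t)))
    (nodes-rows (suc t) l (f ∘ suc) (λ i → trans (eq (suc i)) (ℕ.+-suc t (toℕ i))))

  starts-injective : Injective starts
  starts-injective i j eq = trans (sym (Vec.lookup-allFin i)) (trans eq (Vec.lookup-allFin j))

  indicator : ∀ σ → product rows σ * cycIndicator starts σ ≡ ⟦ isPerm? σ ×-dec (isD? σ ×-dec singleCycle? σ) ⟧
  indicator σ = begin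
    product rows σ * cycIndicator starts σ
      ≡⟨ cong₂ _*_ (product-indicator (λ i a → dPair? (toℕ i) a) rows (λ i a → cong (λ ρ → ρ a) (lookup-rowsFrom dRow 0 i)) σ (isD? σ))
           (cycIndicator-correct starts σ starts-injective (map′ to from d)) ⟩
    ⟦ isD? σ ⟧ * ⟦ map′ to from d ⟧
      ≡⟨ cong (⟦ isD? σ ⟧ *_) (⟦⟧-cong from to (map′ to from d) d) ⟩
    ⟦ isD? σ ⟧ * ⟦ d ⟧
      ≡⟨ ⟦⟧-× (isD? σ) d ⟨
    ⟦ isD? σ ×-dec d ⟧
      ≡⟨ ⟦⟧-cong (λ (x , y , z) → y , x , z) (λ (y , x , z) → x , y , z) (isD? σ ×-dec d) (isPerm? σ ×-dec (isD? σ ×-dec singleCycle? σ)) ⟩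
    ⟦ isPerm? σ ×-dec (isD? σ ×-dec singleCycle? σ) ⟧ ∎
    where
    d = isPerm? σ ×-dec singleCycle? σ
    to : IsPerm σ × SingleCycle σ → Injective σ × Connected starts σ
    to (p , c) = p , singleCycle⇒connected σ c
    from : Injective σ × Connected starts σ → IsPerm σ × SingleCycle σ
    from (p , c) = p , connected⇒singleCycle σ c

numDC-gandhi : ∀ M → + numDC (suc M) ≡ gandhi M 1
numDC-gandhi M = begin
  + dCycleCount (2 ℕ.* suc M)     ≡⟨ cong (λ m → + dCycleCount m) (2*-double (suc M)) ⟩
  + dCycleCount (double (suc M))  ≡⟨ dCycleCount-pairs M ⟩
  pairs cycleBase (suc M) 0       ≡⟨ pairs-zero cycleBase 0 (λ r → ℤ.*-comm (+ suc r) (+ (r ℕ.!))) M ⟩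
  gandhi (M ℕ.+ 0) 1              ≡⟨ cong (λ k → gandhi k 1) (ℕ.+-identityʳ M) ⟩
  gandhi M 1                      ∎

-- Alternating differences and the row operator

alt-map : ∀ (h : A → B) xs g → alt (map h xs) g ≡ alt xs (g ∘ map h)
alt-map h [] g = refl
alt-map h (x ∷ xs) g = cong₂ _-_ (alt-map h xs g) (alt-map h xs (g ∘ (h x ∷_)))

alt-[] : ∀ (xs : List A) g → (∀ x S → g (x ∷ S) ≡ + 0) → alt xs g ≡ g []
alt-[] [] g zeros = refl
alt-[] (x ∷ xs) g zeros = begin
  alt xs g - alt xs (g ∘ (x ∷_))
    ≡⟨ cong₂ _-_ (alt-[] xs g zeros) (trans (alt-cong xs (zeros x)) (alt-zero xs)) ⟩
  g [] - + 0  ≡⟨ ℤ.+-identityʳ _ ⟩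
  g []        ∎

-- Σ (-1)^|T| f (n - |T|) over the subsets T of an n-element set.
Δ : ℕ → (ℕ → ℤ) → ℤ
Δ zero f = f 0
Δ (suc n) f = Δ n (f ∘ suc) - Δ n f

Δ-cong : ∀ n {f g : ℕ → ℤ} → (∀ u → f u ≡ g u) → Δ n f ≡ Δ n g
Δ-cong zero eq = eq 0
Δ-cong (suc n) eq = cong₂ _-_ (Δ-cong n (eq ∘ suc)) (Δ-cong n eq)

Δ-zero : ∀ n → Δ n (λ _ → + 0) ≡ + 0
Δ-zero zero = refl
Δ-zero (suc n) rewrite Δ-zero n = refl

Δ-linear : ∀ n c f g → Δ n (λ u → c * (f u - g u)) ≡ c * (Δ n f - Δ n g)
Δ-linear zero c f g = refl
Δ-linear (suc n) c f g = trans
  (cong₂ _-_ (Δ-linear n c (f ∘ suc) (g ∘ suc)) (Δ-linear n c f g))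
  (lemma c (Δ n (f ∘ suc)) (Δ n (g ∘ suc)) (Δ n f) (Δ n g))
  where
  lemma : ∀ c x y z w → c * (x - y) - c * (z - w) ≡ c * ((x - z) - (y - w))
  lemma = solve-∀

-- The binomial theorem for (y - 1)^n.
Δ-power : ∀ n y c → Δ n (λ u → y ℤ.^ (u ℕ.+ c)) ≡ (y - + 1) ℤ.^ n * y ℤ.^ c
Δ-power zero y c = sym (ℤ.*-identityˡ _)
Δ-power (suc n) y c = begin
  Δ n (λ u → y ℤ.^ (suc u ℕ.+ c)) - Δ n (λ u → y ℤ.^ (u ℕ.+ c))
    ≡⟨ cong₂ _-_ (trans (Δ-cong n (λ u → cong (y ℤ.^_) (sym (ℕ.+-suc u c)))) (Δ-power n y (suc c))) (Δ-power n y c) ⟩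
  (y - + 1) ℤ.^ n * (y * y ℤ.^ c) - (y - + 1) ℤ.^ n * y ℤ.^ c
    ≡⟨ lemma ((y - + 1) ℤ.^ n) y (y ℤ.^ c) ⟩
  (y - + 1) * (y - + 1) ℤ.^ n * y ℤ.^ c ∎
  where
  lemma : ∀ a y b → a * (y * b) - a * b ≡ (y - + 1) * a * b
  lemma = solve-∀

isZero isOne : ℕ → ℤ
isZero b = ⟦ b ℕ.≟ 0 ⟧
isOne b = ⟦ b ℕ.≟ 1 ⟧

Δ-isZero : ∀ n → Δ n isZero ≡ (- + 1) ℤ.^ n
Δ-isZero zero = refl
Δ-isZero (suc n) = begin
  Δ n (isZero ∘ suc) - Δ n isZero
    ≡⟨ cong₂ _-_ (trans (Δ-cong n (λ u → ⟦⟧-no (λ ()) (suc u ℕ.≟ 0))) (Δ-zero n)) (Δ-isZero n) ⟩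
  + 0 - (- + 1) ℤ.^ n      ≡⟨ lemma ((- + 1) ℤ.^ n) ⟩
  (- + 1) * (- + 1) ℤ.^ n  ∎
  where
  lemma : ∀ a → + 0 - a ≡ (- + 1) * a
  lemma = solve-∀

-- One row of the arrangement: a new vertex joins the b blocks, and then a nonempty set of
-- the resulting suc b blocks is merged.
row : (ℕ → ℤ) → ℕ → ℤ
row h b = Δ (suc b) (h ∘ suc) - h (suc (suc b))

row-cong : ∀ {f g : ℕ → ℤ} → (∀ b → f b ≡ g b) → ∀ b → row f b ≡ row g b
row-cong eq b = cong₂ _-_ (Δ-cong (suc b) (eq ∘ suc)) (eq (suc (suc b)))

row-linear : ∀ c f g b → row (λ u → c * (f u - g u)) b ≡ c * (row f b - row g b)
row-linear c f g b = trans (cong (_- c * (f (suc (suc b)) - g (suc (suc b)))) (Δ-linear (suc b) c (f ∘ suc) (g ∘ suc)))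
  (lemma c (Δ (suc b) (f ∘ suc)) (Δ (suc b) (g ∘ suc)) (f (suc (suc b))) (g (suc (suc b))))
  where
  lemma : ∀ c x y z w → c * (x - y) - c * (z - w) ≡ c * ((x - z) - (y - w))
  lemma = solve-∀

rows : ℕ → (ℕ → ℤ) → ℕ → ℤ
rows zero h = h
rows (suc n) h = rows n (row h)

rows-cong : ∀ n {f g : ℕ → ℤ} → (∀ b → f b ≡ g b) → ∀ b → rows n f b ≡ rows n g b
rows-cong zero eq = eq
rows-cong (suc n) eq = rows-cong n (row-cong eq)

rows-linear : ∀ n c f g b → rows n (λ u → c * (f u - g u)) b ≡ c * (rows n f b - rows n g b)
rows-linear zero c f g b = refl
rows-linear (suc n) c f g b = trans (rows-cong n (row-linear c f g) b) (rows-linear n c (row f) (row g) b)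

-- Up to the factor -x, the number of colourings of the blocks with -x colours.
colourings : ℕ → ℕ → ℤ
colourings x b = (- + x) ℤ.^ suc b

-- With y = -x the binomial factor y - 1 equals -(x+1), so merging acts as the shift of x. Of the
-- two factors y that give x², one belongs to the merged block and one to the extra 1 in the
-- exponent.
row-colourings : ∀ x b → row (colourings x) b ≡ + x * + x * (colourings (suc x) b - colourings x b)
row-colourings x b = begin
  Δ (suc b) (λ u → y ℤ.^ suc (suc u)) - y ℤ.^ suc (suc (suc b))
    ≡⟨ cong (_- y ℤ.^ suc (suc (suc b))) (trans (Δ-cong (suc b) (λ u → cong (y ℤ.^_) (ℕ.+-comm 2 u))) (Δ-power (suc b) y 2)) ⟩
  (y - + 1) ℤ.^ suc b * y ℤ.^ 2 - y ℤ.^ suc (suc (suc b))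
    ≡⟨ cong (λ z → z ℤ.^ suc b * y ℤ.^ 2 - y ℤ.^ suc (suc (suc b))) (shifted (+ x)) ⟩
  (- + suc x) ℤ.^ suc b * y ℤ.^ 2 - y ℤ.^ suc (suc (suc b))
    ≡⟨ lemma (+ x) ((- + suc x) ℤ.^ suc b) (y ℤ.^ suc b) ⟩
  + x * + x * (colourings (suc x) b - colourings x b) ∎
  where
  y = - + x
  shifted : ∀ a → (- a) - + 1 ≡ - (+ 1 + a)
  shifted = solve-∀
  lemma : ∀ a p q → p * ((- a) * ((- a) * + 1)) - (- a) * ((- a) * q) ≡ a * a * (p - q)
  lemma = solve-∀

-- One block remains only if all suc b blocks are merged, so a single term with sign (-1)^(b+1)
-- survives.
row-isOne : ∀ b → row isOne b ≡ colourings 1 b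
row-isOne b = begin
  Δ (suc b) (isOne ∘ suc) - isOne (suc (suc b))
    ≡⟨ cong₂ _-_ (Δ-cong (suc b) (λ u → ⟦⟧-cong ℕ.suc-injective (cong suc) (suc u ℕ.≟ 1) (u ℕ.≟ 0)))
         (⟦⟧-no (λ ()) (suc (suc b) ℕ.≟ 1)) ⟩
  Δ (suc b) isZero - + 0      ≡⟨ ℤ.+-identityʳ _ ⟩
  Δ (suc b) isZero            ≡⟨ Δ-isZero (suc b) ⟩
  colourings 1 b              ∎

rows-colourings : ∀ n x → rows n (colourings x) 0 ≡ - gandhi n x
-- Without blocks the power is -x itself; this is the source of the sign in the theorem.
rows-colourings zero x = ℤ.*-identityʳ _
rows-colourings (suc n) x = begin
  rows n (row (colourings x)) 0
    ≡⟨ rows-cong n (row-colourings x) 0 ⟩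
  rows n (λ b → + x * + x * (colourings (suc x) b - colourings x b)) 0
    ≡⟨ rows-linear n (+ x * + x) (colourings (suc x)) (colourings x) 0 ⟩
  + x * + x * (rows n (colourings (suc x)) 0 - rows n (colourings x) 0)
    ≡⟨ cong₂ (λ a b → + x * + x * (a - b)) (rows-colourings n (suc x)) (rows-colourings n x) ⟩
  + x * + x * (- gandhi n (suc x) - - gandhi n x)
    ≡⟨ lemma (+ x * + x) (gandhi n (suc x)) (gandhi n x) ⟩
  - (+ x * + x * (gandhi n (suc x) - gandhi n x)) ∎
  where
  lemma : ∀ c a b → c * (- a - - b) ≡ - (c * (a - b))
  lemma = solve-∀

-- Alternating sums that see only the labels hit

module _ {V : Set} (_≟_ : DecidableEquality V) where

  unhit : List V → List V → List V
  unhit R L = filter (λ r → ¬? (mem? _≟_ r L)) R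

  filter-cong : ∀ {P Q : V → Set} (P? : Decidable P) (Q? : Decidable Q) xs →
    (∀ {x} → x ∈ xs → P x → Q x) → (∀ {x} → x ∈ xs → Q x → P x) → filter P? xs ≡ filter Q? xs
  filter-cong P? Q? [] f g = refl
  filter-cong P? Q? (x ∷ xs) f g with P? x | Q? x
  ... | yes _ | yes _ = cong (x ∷_) (filter-cong P? Q? xs (f ∘ there) (g ∘ there))
  ... | no _ | no _ = filter-cong P? Q? xs (f ∘ there) (g ∘ there)
  ... | yes p | no ¬q = contradiction (f (here refl) p) ¬q
  ... | no ¬p | yes q = contradiction (g (here refl) q) ¬p

  unhit-cong : ∀ R {L M} → (∀ {r} → r ∈ R → r ∈ L → r ∈ M) → (∀ {r} → r ∈ R → r ∈ M → r ∈ L) → unhit R L ≡ unhit R M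
  unhit-cong R f g = filter-cong _ _ R (λ r∈ r∉L r∈M → r∉L (g r∈ r∈M)) (λ r∈ r∉M r∈L → r∉M (f r∈ r∈L))

  module _ {W : Set} (lab : W → V) where

    -- Once r is hit, a further element with label r changes nothing, so the sets with and without
    -- it cancel.
    alt-redundant : ∀ (Φ : List V → ℤ) → (∀ {L M} → L ⊆ M → M ⊆ L → Φ L ≡ Φ M) →
      ∀ r ws → r ∈ map lab ws → alt ws (λ S → Φ (r ∷ map lab S)) ≡ + 0
    alt-redundant Φ resp r (w ∷ ws) (here refl) = ℤ.i≡j⇒i-j≡0
      (alt-cong ws (λ S → resp there (λ { (here p) → here p ; (there p) → p })))
    alt-redundant Φ resp r (w ∷ ws) (there r∈) = cong₂ _-_ (alt-redundant Φ resp r ws r∈)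
      (trans (alt-cong ws (λ S → resp exchange exchange))
        (alt-redundant (λ L → Φ (lab w ∷ L)) (λ s t → resp (mono s) (mono t)) r ws r∈))
      where
      exchange : ∀ {a b : V} {L} → a ∷ b ∷ L ⊆ b ∷ a ∷ L
      exchange (here p) = there (here p)
      exchange (there (here p)) = here p
      exchange (there (there p)) = there (there p)
      mono : ∀ {a : V} {L M} → L ⊆ M → a ∷ L ⊆ a ∷ M
      mono s (here p) = here p
      mono s (there p) = there (s p)

    -- Only the set of labels hit by S matters, and several elements with the same label
    -- act like a single one.
    alt-labels : ∀ ws R f → Unique R → (∀ {w} → w ∈ ws → lab w ∈ R) → R ⊆ map lab ws →
      alt ws (λ S → f (length (unhit R (map lab S)))) ≡ Δ (length R) f
    alt-labels [] [] f uniq into onto = refl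
    alt-labels [] (r ∷ R) f uniq into onto with onto (here refl)
    ... | ()
    alt-labels (w ∷ ws) R f uniq into onto with mem? _≟_ (lab w) (map lab ws)
    ... | yes again = begin
      alt ws (λ S → f (length (unhit R (map lab S)))) - alt ws (λ S → f (length (unhit R (lab w ∷ map lab S))))
        ≡⟨ cong₂ _-_ (alt-labels ws R f uniq (into ∘ there) onto′)
             (alt-redundant (λ L → f (length (unhit R L))) (λ s t → cong (f ∘ length) (unhit-cong R (λ _ → s) (λ _ → t))) (lab w) ws again) ⟩
      Δ (length R) f - + 0 ≡⟨ ℤ.+-identityʳ _ ⟩
      Δ (length R) f       ∎
      where
      onto′ : R ⊆ map lab ws
      onto′ r∈ with onto r∈
      ... | here refl = again
      ... | there p = p
    ... | no new with ∈-∃++ (into (here refl))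
    ...   | R₁ , R₂ , refl = begin
      alt ws (λ S → f (length (unhit R (map lab S)))) - alt ws (λ S → f (length (unhit R (lab w ∷ map lab S))))
        ≡⟨ cong₂ _-_ (alt-cong⊆ ws without) (alt-cong⊆ ws with-w) ⟩
      alt ws (λ S → f (suc (length (unhit R′ (map lab S))))) - alt ws (λ S → f (length (unhit R′ (map lab S))))
        ≡⟨ cong₂ _-_ (alt-labels ws R′ (f ∘ suc) uniq′ into′ onto′) (alt-labels ws R′ f uniq′ into′ onto′) ⟩
      Δ (suc (length R′)) f
        ≡⟨ cong (λ n → Δ n f) (↭-length R↭) ⟨
      Δ (length R) f ∎
      where
      R′ = R₁ ++ R₂
      R↭ : R ↭ lab w ∷ R′
      R↭ = shift (lab w) R₁ R₂
      uniq″ : Unique (lab w ∷ R′)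
      uniq″ = Unique-resp-↭ (setoid V) (↭.↭⇒↭ₛ R↭) uniq
      uniq′ : Unique R′
      uniq′ with uniq″
      ... | _ ∷ u = u
      lab-w∉ : ¬ lab w ∈ R′
      lab-w∉ p with uniq″
      ... | fresh ∷ _ = All.lookup fresh p refl
      into′ : ∀ {v} → v ∈ ws → lab v ∈ R′
      into′ v∈ with ∈-resp-↭ R↭ (into (there v∈))
      ... | here eq = contradiction (subst (_∈ map lab ws) eq (∈-map⁺ lab v∈)) new
      ... | there p = p
      onto′ : R′ ⊆ map lab ws
      onto′ r∈ with onto (∈-resp-↭ (↭.↭-sym R↭) (there r∈))
      ... | here refl = contradiction r∈ lab-w∉
      ... | there p = p
      without : ∀ S → S ⊆ ws → f (length (unhit R (map lab S))) ≡ f (suc (length (unhit R′ (map lab S))))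
      without S S⊆ = cong f (trans (↭-length (filter-↭ _ R↭)) (cong length (List.filter-accept (λ r → ¬? (mem? _≟_ r (map lab S))) lab-w∉S)))
        where
        lab-w∉S : ¬ lab w ∈ map lab S
        lab-w∉S p with ∈-map⁻ lab p
        ... | v , v∈ , eq = new (subst (_∈ map lab ws) (sym eq) (∈-map⁺ lab (S⊆ v∈)))
      with-w : ∀ S → S ⊆ ws → f (length (unhit R (lab w ∷ map lab S))) ≡ f (length (unhit R′ (map lab S)))
      with-w S S⊆ = cong f (begin
        length (unhit R (lab w ∷ map lab S))
          ≡⟨ ↭-length (filter-↭ _ R↭) ⟩
        length (unhit (lab w ∷ R′) (lab w ∷ map lab S))
          ≡⟨ cong length (List.filter-reject (λ r → ¬? (mem? _≟_ r (lab w ∷ map lab S))) (λ fresh → fresh (here refl))) ⟩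
        length (unhit R′ (lab w ∷ map lab S))
          ≡⟨ cong length (unhit-cong R′
               (λ { r∈ (here refl) → contradiction r∈ lab-w∉ ; _ (there p) → p }) (λ _ → there)) ⟩
        length (unhit R′ (map lab S)) ∎)

-- Components of the bipartite graph

-‿cancelˡ : ∀ a {b c} → a ℚ.- b ≡ a ℚ.- c → b ≡ c
-‿cancelˡ a eq = ℚ.neg-injective (∙-cancelˡ a _ _ eq)
  where open import Algebra.Properties.AbelianGroup ℚ.+-0-abelianGroup using (∙-cancelˡ)

module _ {k : ℕ} where

  _∈V?_ : (v : Fin k) (L : List (Fin k)) → Dec (v ∈ L)
  _∈V?_ = mem? Fin._≟_

  unhitV : List (Fin k) → List (Fin k) → List (Fin k)
  unhitV = unhit Fin._≟_

  Isolated : ℕ → List (Hyp k) → Set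
  Isolated s S = Σ (Fin k) λ i → Σ (Fin k) λ w → s ≤ toℕ i × i Fin.< w × (∀ v → ¬ (i , v) ∈ S)

  -- The hyperplane (i , v) is an edge joining u_i = x_i - y_i and x_v.  A Partition records the
  -- connected components of the graph S on the vertices x_v with t < v and u_i with s ≤ i,
  -- when no u_i is isolated: a component is named by one of the v in it.
  record Partition (t s : ℕ) (S : List (Hyp k)) (b : ℕ) : Set where
    field
      label       : Fin k → Fin k
      labelᵘ      : Fin k → Fin k
      blocks      : List (Fin k)
      size        : length blocks ≡ b
      distinct    : Unique blocks
      label∈      : ∀ {v} → t < toℕ v → label v ∈ blocks
      block>      : ∀ {r} → r ∈ blocks → t < toℕ r
      block-label : ∀ {r} → r ∈ blocks → label r ≡ r
      edge        : ∀ {i v} → (i , v) ∈ S → s ≤ toℕ i × i Fin.< v × labelᵘ i ≡ label v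
      forced      : ∀ p → InInter S p → ∀ v → t < toℕ v → proj₁ p v ≡ proj₁ p (label v)
      attached    : ∀ i → s ≤ toℕ i → suc (toℕ i) < k →
                    ∃ λ v → i Fin.< v × (∀ p → InInter S p → OnHyp (i , v) p)

  -- Here t is the last index: no x_v is left, and the only u_i is the last one, which lies on no
  -- hyperplane and is exempt from `attached`.
  empty : ∀ {t} → suc t ≡ k → Partition t t [] 0
  empty {t} eq = record
    { label = id ; labelᵘ = id ; blocks = [] ; size = refl ; distinct = []
    ; label∈ = λ {v} t<v → contradiction (Fin.toℕ<n v) (ℕ.≤⇒≯ (subst (_≤ toℕ v) eq t<v))
    ; block> = λ () ; block-label = λ () ; edge = λ ()
    ; forced = λ _ _ _ _ → refl
    ; attached = λ i t≤i i<k → contradiction (ℕ.≤-trans i<k (ℕ.≤-reflexive (sym eq))) (ℕ.≤⇒≯ (s≤s t≤i))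
    }

  addVertex : ∀ {t s S b} (w : Fin k) → toℕ w ≡ suc t → t < s → Partition (suc t) s S b → Partition t s S (suc b)
  addVertex {t} {s} {S} {b} w w≡ t<s P = record
    { label = label′ ; labelᵘ = labelᵘ ; blocks = w ∷ blocks ; size = cong suc size
    ; distinct = All.tabulate (λ r∈ → <⇒≢w (block> r∈) ∘ sym) ∷ distinct
    ; label∈ = label∈′
    ; block> = λ { (here refl) → ℕ.≤-reflexive (sym w≡) ; (there r∈) → ℕ.<⇒≤ (block> r∈) }
    ; block-label = λ { (here refl) → label′-w ; (there r∈) → trans (label′-≢ (<⇒≢w (block> r∈))) (block-label r∈) }
    -- An existing edge (i , v) has t < s ≤ i < v, so it does not end in the new vertex w.
    ; edge = λ e → let s≤i , i<v , eq = edge e in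
        s≤i , i<v , trans eq (sym (label′-≢ (<⇒≢w (ℕ.≤-trans (s≤s (ℕ.≤-trans t<s s≤i)) i<v))))
    ; forced = forced′
    ; attached = attached
    }
    where
    open Partition P
    label′ : Fin k → Fin k
    label′ v with v Fin.≟ w
    ... | yes _ = w
    ... | no _ = label v
    label′-w : label′ w ≡ w
    label′-w with w Fin.≟ w
    ... | yes _ = refl
    ... | no w≢w = contradiction refl w≢w
    label′-≢ : ∀ {v} → ¬ v ≡ w → label′ v ≡ label v
    label′-≢ {v} v≢w with v Fin.≟ w
    ... | yes v≡w = contradiction v≡w v≢w
    ... | no _ = refl
    <⇒≢w : ∀ {v} → suc t < toℕ v → ¬ v ≡ w
    <⇒≢w t<v refl = ℕ.<-irrefl (sym w≡) t<v
    ≢w⇒< : ∀ {v} → t < toℕ v → ¬ v ≡ w → suc t < toℕ v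
    ≢w⇒< t<v v≢w = ℕ.≤∧≢⇒< t<v (λ eq → v≢w (Fin.toℕ-injective (trans (sym eq) (sym w≡))))
    label∈′ : ∀ {v} → t < toℕ v → label′ v ∈ w ∷ blocks
    label∈′ {v} t<v with v Fin.≟ w
    ... | yes _ = here refl
    ... | no v≢w = there (label∈ (≢w⇒< t<v v≢w))
    forced′ : ∀ p → InInter S p → ∀ v → t < toℕ v → proj₁ p v ≡ proj₁ p (label′ v)
    forced′ p pS v t<v with v Fin.≟ w
    ... | yes refl = refl
    ... | no v≢w = forced p pS v (≢w⇒< t<v v≢w)

  -- All blocks that contain a neighbour of u_i become one block, named after the block of the first
  -- neighbour a. The list of neighbours is nonempty, so u_i is attached.
  addRow : ∀ {t S b} (i : Fin k) → toℕ i ≡ t → (P : Partition t (suc t) S b) → let open Partition P in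
    ∀ a A → All (λ v → t < toℕ v) (a ∷ A) →
    Partition t t (map (i ,_) (a ∷ A) ++ S) (suc (length (unhitV blocks (map label (a ∷ A)))))
  addRow {t} {S} {b} i i≡ P a A A> = record
    { label = merge ∘ label ; labelᵘ = labelᵘ′ ; blocks = c ∷ unhitV blocks hit ; size = refl
    ; distinct = All.tabulate (λ r∈ c≡r → unhit∉ r∈ (subst (_∈ hit) c≡r (here refl)))
        ∷ Unique.filter⁺ (λ r → ¬? (r ∈V? hit)) distinct
    ; label∈ = λ t<v → merge∈ (label∈ t<v)
    ; block> = λ { (here refl) → block> c∈ ; (there r∈) → block> (unhit⊆ r∈) }
    ; block-label = λ
        { (here refl) → trans (cong merge (block-label c∈)) (merge-hit (here refl))
        ; (there r∈) → trans (cong merge (block-label (unhit⊆ r∈))) (merge-unhit (unhit∉ r∈)) }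
    ; edge = edge′
    ; forced = forced′
    ; attached = attached′
    }
    where
    open Partition P
    hit = map label (a ∷ A)
    c = label a

    merge : Fin k → Fin k
    merge r with r ∈V? hit
    ... | yes _ = c
    ... | no _ = r

    merge-hit : ∀ {r} → r ∈ hit → merge r ≡ c
    merge-hit {r} r∈ with r ∈V? hit
    ... | yes _ = refl
    ... | no r∉ = contradiction r∈ r∉

    merge-unhit : ∀ {r} → ¬ r ∈ hit → merge r ≡ r
    merge-unhit {r} r∉ with r ∈V? hit
    ... | yes r∈ = contradiction r∈ r∉
    ... | no _ = refl

    merge∈ : ∀ {r} → r ∈ blocks → merge r ∈ c ∷ unhitV blocks hit
    merge∈ {r} r∈ with r ∈V? hit
    ... | yes _ = here refl
    ... | no r∉ = there (∈-filter⁺ (λ r → ¬? (r ∈V? hit)) r∈ r∉)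

    unhit⊆ : ∀ {r} → r ∈ unhitV blocks hit → r ∈ blocks
    unhit⊆ r∈ = proj₁ (∈-filter⁻ (λ r → ¬? (r ∈V? hit)) r∈)

    unhit∉ : ∀ {r} → r ∈ unhitV blocks hit → ¬ r ∈ hit
    unhit∉ r∈ = proj₂ (∈-filter⁻ (λ r → ¬? (r ∈V? hit)) {xs = blocks} r∈)

    c∈ : c ∈ blocks
    c∈ = label∈ (All.lookup A> (here refl))

    labelᵘ′ : Fin k → Fin k
    labelᵘ′ j with j Fin.≟ i
    ... | yes _ = c
    ... | no _ = merge (labelᵘ j)

    labelᵘ′-i : labelᵘ′ i ≡ c
    labelᵘ′-i with i Fin.≟ i
    ... | yes _ = refl
    ... | no i≢i = contradiction refl i≢i

    labelᵘ′-≢ : ∀ {j} → ¬ j ≡ i → labelᵘ′ j ≡ merge (labelᵘ j)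
    labelᵘ′-≢ {j} j≢i with j Fin.≟ i
    ... | yes j≡i = contradiction j≡i j≢i
    ... | no _ = refl

    edge′ : ∀ {j v} → (j , v) ∈ map (i ,_) (a ∷ A) ++ S → t ≤ toℕ j × j Fin.< v × labelᵘ′ j ≡ merge (label v)
    edge′ {j} {v} e with ∈-++⁻ (map (i ,_) (a ∷ A)) e
    ... | inj₁ new with ∈-map⁻ (i ,_) new
    ...   | _ , v∈ , refl = ℕ.≤-reflexive (sym i≡) , ℕ.≤-<-trans (ℕ.≤-reflexive i≡) (All.lookup A> v∈) ,
      trans labelᵘ′-i (sym (merge-hit (∈-map⁺ label v∈)))
    edge′ {j} {v} e | inj₂ old with edge old
    ...   | t<j , j<v , eq = ℕ.<⇒≤ t<j , j<v ,
      trans (labelᵘ′-≢ (λ { refl → ℕ.<-irrefl (sym i≡) t<j })) (cong merge eq)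

    on-new : ∀ p → InInter (map (i ,_) (a ∷ A) ++ S) p → ∀ {v} → v ∈ a ∷ A → OnHyp (i , v) p
    on-new p pS v∈ = All.lookup pS (∈-++⁺ˡ (∈-map⁺ (i ,_) v∈))

    on-old : ∀ p → InInter (map (i ,_) (a ∷ A) ++ S) p → InInter S p
    on-old p pS = All.tabulate (All.lookup pS ∘ ∈-++⁺ʳ (map (i ,_) (a ∷ A)))

    forced′ : ∀ p → InInter (map (i ,_) (a ∷ A) ++ S) p → ∀ v → t < toℕ v → proj₁ p v ≡ proj₁ p (merge (label v))
    forced′ p pS v t<v with label v ∈V? hit
    ... | no _ = forced p (on-old p pS) v t<v
    ... | yes hit∈ with ∈-map⁻ label hit∈
    ...   | v′ , v′∈ , eq = begin
      x v          ≡⟨ forced p (on-old p pS) v t<v ⟩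
      x (label v)  ≡⟨ cong x eq ⟩
      x (label v′) ≡⟨ forced p (on-old p pS) v′ (All.lookup A> v′∈) ⟨
      -- Two equations with the same first index i share x_i and y_i, so their second coordinates
      -- agree.
      x v′         ≡⟨ -‿cancelˡ (x i) (trans (on-new p pS v′∈) (sym (on-new p pS (here refl)))) ⟩
      x a          ≡⟨ forced p (on-old p pS) a (All.lookup A> (here refl)) ⟩
      x c          ∎
      where x = proj₁ p

    attached′ : ∀ j → t ≤ toℕ j → suc (toℕ j) < k →
      ∃ λ v → j Fin.< v × (∀ p → InInter (map (i ,_) (a ∷ A) ++ S) p → OnHyp (j , v) p)
    attached′ j t≤j j<k with ℕ.m≤n⇒m<n∨m≡n t≤j
    ... | inj₁ t<j = let v , j<v , on = attached j t<j j<k in v , j<v , λ p → on p ∘ on-old p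
    ... | inj₂ t≡j with Fin.toℕ-injective (trans i≡ t≡j)
    ...   | refl = a , ℕ.≤-<-trans (ℕ.≤-reflexive i≡) (All.lookup A> (here refl)) , λ p pS → on-new p pS (here refl)

  hypRow : Fin k → List (Hyp k)
  hypRow i = map (i ,_) (filter (i Fin.<?_) (allFin k))

  -- A nonempty neighbourhood of u_i yields a partition whose size depends only on the number of
  -- blocks hit, so the sum over edge sets collapses to a sum over sets of blocks.
  row-sum : ∀ {t S b} (i w : Fin k) → toℕ i ≡ t → toℕ w ≡ suc t → ∀ (g : List (Hyp k) → ℤ) h →
    (∀ T c → Partition t t T c → g T ≡ h c) → (∀ T → Isolated t T → g T ≡ + 0) →
    Partition (suc t) (suc t) S b → alt (hypRow i) (λ A → g (A ++ S)) ≡ row h b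
  row-sum {t} {S} {b} i w i≡ w≡ g h good bad P = begin
    alt (hypRow i) (λ A → g (A ++ S))
      ≡⟨ alt-map (i ,_) vs _ ⟩
    alt vs (λ A → g (map (i ,_) A ++ S))
      ≡⟨ alt-cong⊆ vs by-first ⟩
    alt vs (λ A → h (suc (length (unhitV blocks (map label A)))) - correction A)
      ≡⟨ alt-- vs _ _ ⟩
    alt vs (λ A → h (suc (length (unhitV blocks (map label A))))) - alt vs correction
      ≡⟨ cong₂ _-_ (alt-labels Fin._≟_ label vs blocks (h ∘ suc) distinct
                      (λ v∈ → label∈ (vs> v∈))
                      (λ {r} r∈ → subst (_∈ map label vs) (block-label r∈) (∈-map⁺ label (vs⁺ (block> r∈)))))
                   (alt-[] vs correction (λ _ _ → refl)) ⟩
    Δ (length blocks) (h ∘ suc) - h (suc (suc b))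
      ≡⟨ cong (λ n → Δ n (h ∘ suc) - h (suc (suc b))) size ⟩
    row h b ∎
    where
    P′ : Partition t (suc t) S (suc b)
    P′ = addVertex w w≡ ℕ.≤-refl P
    open Partition P′

    vs = filter (i Fin.<?_) (allFin k)
    vs> : ∀ {v} → v ∈ vs → t < toℕ v
    vs> v∈ = subst (_< _) i≡ (proj₂ (∈-filter⁻ (i Fin.<?_) {xs = allFin k} v∈))
    vs⁺ : ∀ {v} → t < toℕ v → v ∈ vs
    vs⁺ {v} t<v = ∈-filter⁺ (i Fin.<?_) (∈-allFin v) (subst (_< toℕ v) (sym i≡) t<v)

    -- With A empty the vertex u_i is isolated, and the general formula has to be cancelled.
    correction : List (Fin k) → ℤ
    correction [] = h (suc (suc b))
    correction (_ ∷ _) = + 0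

    by-first : ∀ A → A ⊆ vs →
      g (map (i ,_) A ++ S) ≡ h (suc (length (unhitV blocks (map label A)))) - correction A
    by-first [] _ = begin
      g S
        ≡⟨ bad S (i , w , ℕ.≤-reflexive (sym i≡) , ℕ.≤-reflexive (trans (cong suc i≡) (sym w≡)) ,
             λ v e → ℕ.<-irrefl (sym i≡) (proj₁ (edge e))) ⟩
      + 0
        ≡⟨ ℤ.+-inverseʳ (h (suc (suc b))) ⟨
      h (suc (suc b)) - h (suc (suc b))
        ≡⟨ cong (λ n → h (suc n) - h (suc (suc b)))
             (trans (cong length (filter-all (λ r → ¬? (r ∈V? [])) (All.universal (λ _ ()) blocks))) size) ⟨
      h (suc (length (unhitV blocks []))) - h (suc (suc b)) ∎
    by-first (a ∷ A) A⊆ = trans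
      (good _ _ (addRow i i≡ P′ a A (All.tabulate (vs> ∘ A⊆))))
      (sym (ℤ.+-identityʳ _))

  -- The inner sum over the row of smallest index satisfies the same two hypotheses as g, with
  -- `row h` for h. A u_i isolated in the outer rows remains so, because the new edges all have
  -- first index t < i.
  rows-sum : ∀ l t (f : Fin (suc l) → Fin k) → (∀ j → toℕ (f j) ≡ t ℕ.+ toℕ j) → suc (t ℕ.+ l) ≡ k → ∀ (g : List (Hyp k) → ℤ) h →
    (∀ S b → Partition t t S b → g S ≡ h b) → (∀ S → Isolated t S → g S ≡ + 0) →
    alt (concatMap hypRow (tabulate f)) g ≡ rows l h 0
  rows-sum zero t f f≡ tot g h good bad = begin
    alt (hypRow (f zero) ++ []) g
      -- No index exceeds the last one, so its row is empty; this is why suc l rows give only l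
      -- operators.
      ≡⟨ cong (λ xs → alt (map (f zero ,_) xs ++ []) g) (filter-none (f zero Fin.<?_) (All.universal last (allFin k))) ⟩
    g []
      ≡⟨ good [] 0 (empty (trans (cong suc (sym (ℕ.+-identityʳ t))) tot)) ⟩
    h 0 ∎
    where
    last : ∀ v → ¬ (f zero Fin.< v)
    last v lt = ℕ.<⇒≱ (Fin.toℕ<n v) (subst (_≤ toℕ v) (trans (cong suc (f≡ zero)) tot) lt)
  rows-sum (suc l) t f f≡ tot g h good bad = begin
    alt (hypRow (f zero) ++ concatMap hypRow (tabulate (f ∘ suc))) g
      ≡⟨ alt-++ (hypRow (f zero)) (concatMap hypRow (tabulate (f ∘ suc))) g ⟩
    alt (concatMap hypRow (tabulate (f ∘ suc))) (λ S → alt (hypRow (f zero)) (λ A → g (A ++ S)))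
      ≡⟨ rows-sum l (suc t) (f ∘ suc) (λ j → trans (f≡ (suc j)) (ℕ.+-suc t (toℕ j))) (trans (cong suc (sym (ℕ.+-suc t l))) tot)
           (λ S → alt (hypRow (f zero)) (λ A → g (A ++ S))) (row h)
           (λ S b P → row-sum (f zero) (f (suc zero)) f0≡ (trans (f≡ (suc zero)) (trans (ℕ.+-suc t 0) (cong suc (ℕ.+-identityʳ t)))) g h good bad P)
           isolated ⟩
    rows l (row h) 0 ∎
    where
    f0≡ : toℕ (f zero) ≡ t
    f0≡ = trans (f≡ zero) (ℕ.+-identityʳ t)

    isolated : ∀ S → Isolated (suc t) S → alt (hypRow (f zero)) (λ A → g (A ++ S)) ≡ + 0
    isolated S (i , w , t<i , i<w , none) =
      trans (alt-cong⊆ (hypRow (f zero)) λ A A⊆ → bad (A ++ S) (i , w , ℕ.<⇒≤ t<i , i<w , none′ A A⊆)) (alt-zero (hypRow (f zero)))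
      where
      none′ : ∀ A → A ⊆ hypRow (f zero) → ∀ v → ¬ (i , v) ∈ A ++ S
      none′ A A⊆ v e with ∈-++⁻ A e
      ... | inj₂ e∈S = none v e∈S
      ... | inj₁ e∈A with ∈-map⁻ (f zero ,_) (A⊆ e∈A)
      ...   | _ , _ , refl = ℕ.<-irrefl (sym f0≡) t<i

  filter-concatMap : ∀ {R : B → Set} (R? : Decidable R) (h : A → List B) xs →
    filter R? (concatMap h xs) ≡ concatMap (filter R? ∘ h) xs
  filter-concatMap R? h [] = refl
  filter-concatMap R? h (x ∷ xs) = trans (filter-++ R? (h x) (concatMap h xs)) (cong (filter R? (h x) ++_) (filter-concatMap R? h xs))

  filter-map : ∀ {R : B → Set} (R? : Decidable R) (h : A → B) xs → filter R? (map h xs) ≡ map h (filter (R? ∘ h) xs)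
  filter-map R? h [] = refl
  filter-map R? h (x ∷ xs) with R? (h x)
  ... | yes _ = cong (h x ∷_) (filter-map R? h xs)
  ... | no _ = filter-map R? h xs

  hyps-rows : hyps k ≡ concatMap hypRow (allFin k)
  hyps-rows = trans (filter-concatMap (λ p → proj₁ p Fin.<? proj₂ p) (λ i → map (i ,_) (allFin k)) (allFin k))
    (concatMap-cong (λ i → filter-map (λ p → proj₁ p Fin.<? proj₂ p) (i ,_) (allFin k)) (allFin k))

-- Spanning edge sets

-- Changing y_i alone moves u_i and respects every hyperplane in S, but not (i , w).
isolated⇒¬spans : ∀ {k S} → Isolated {k} 0 S → ¬ (hyps k ≤L S)
isolated⇒¬spans {S = S} (i , w , _ , i<w , none) span =
  unitPoint-off i w (All.lookup (span (unitPoint i) on) (∈-hyps⁺ i<w))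
  where
  on : InInter S (unitPoint i)
  on = All.tabulate λ { {j , v} e → unitPoint-on {i = i} {j} v (λ { refl → none v e }) }

module _ {n : ℕ} {S : List (Hyp (suc (suc n)))} where

  -- Each u_i is tied to some x_v, and all these x_v coincide, so u_i equals x_j for every other j
  -- as well.
  oneBlock⇒spans : Partition 0 0 S 1 → hyps (suc (suc n)) ≤L S
  oneBlock⇒spans P p pS with Partition.blocks P | Partition.size P | Partition.label∈ P
  ... | r ∷ [] | refl | label∈ = All.tabulate on
    where
    open Partition P using (attached; forced)
    x = proj₁ p
    same : ∀ v → 0 < toℕ v → x v ≡ x r
    same v 0<v with label∈ 0<v
    ... | here eq = trans (forced p pS v 0<v) (cong x eq)
    on : ∀ {H} → H ∈ hyps (suc (suc n)) → OnHyp H p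
    on {i , j} H∈ with attached i z≤n (ℕ.≤-<-trans i<j (Fin.toℕ<n j))
      where
      i<j : i Fin.< j
      i<j = ∈-hyps⁻ H∈
    ... | v , i<v , on-v = trans
      (cong (λ z → x i ℚ.- z) (trans (same j (ℕ.≤-<-trans z≤n (∈-hyps⁻ H∈))) (sym (same v (ℕ.≤-<-trans z≤n i<v)))))
      (on-v p pS)

  -- Two blocks would be separated by a point that takes the value 1 on one component and 0 on the
  -- others.
  spans⇒oneBlock : ∀ {b} → Partition 0 0 S b → hyps (suc (suc n)) ≤L S → b ≡ 1
  spans⇒oneBlock P span with Partition.blocks P | Partition.size P | Partition.label∈ P | Partition.block> P | Partition.block-label P | Partition.distinct P
  -- There are at least two indices, so x_1 lies in some block.
  ... | [] | _ | label∈ | _ | _ | _ with () ← label∈ {suc zero} (s≤s z≤n)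
  ... | r ∷ [] | refl | _ | _ | _ | _ = refl
  ... | r ∷ r′ ∷ _ | _ | _ | block> | block-label | (r≢ ∷ _) ∷ _ = contradiction r′≡r (r≢ ∘ sym)
    where
    open Partition P using (label; labelᵘ; edge)

    separate : Fin (suc (suc n)) → ℚ
    separate v = if does (v Fin.≟ r) then 1ℚ else 0ℚ

    x : Fin (suc (suc n)) → ℚ
    x = separate ∘ label

    p : Point (suc (suc n))
    -- The choice of y gives u_i the value of its own component.
    p = x , λ i → x i ℚ.- separate (labelᵘ i)

    on : InInter S p
    on = All.tabulate λ { {i , v} e → cong (λ z → x i ℚ.- separate z) (sym (proj₂ (proj₂ (edge e)))) }

    x≡ : x r ≡ x r′
    -- Block names are positive, so both blocks meet hyperplanes with first index 0, and these force
    -- equal coordinates.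
    x≡ = -‿cancelˡ (x zero) (trans
      (All.lookup (span p on) (∈-hyps⁺ (block> (here refl))))
      (sym (All.lookup (span p on) (∈-hyps⁺ (block> (there (here refl)))))))

    separate-r : separate r ≡ 1ℚ
    separate-r with r Fin.≟ r
    ... | yes _ = refl
    ... | no r≢r = contradiction refl r≢r

    r′≡r : r′ ≡ r
    r′≡r with r′ Fin.≟ r in eq
    ... | yes r′≡r = r′≡r
    ... | no _ = contradiction (trans (sym separate-r) (trans (cong separate (sym (block-label (here refl))))
        (trans x≡ (cong separate (block-label (there (here refl)))))))
      (λ 1≡ → case trans 1≡ (cong (λ d → if does d then 1ℚ else 0ℚ) eq) of λ ())

μH-gandhi : ∀ M (dec : InterSubDec (suc (suc M))) → μH (suc M) dec ≡ - gandhi M 1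
μH-gandhi M dec = begin
  μH (suc M) dec
    ≡⟨ möbius-spanning dec ⟩
  alt (hyps (suc (suc M))) (λ S → ⟦ spans? dec S ⟧)
    ≡⟨ cong (λ Hs → alt Hs (λ S → ⟦ spans? dec S ⟧)) hyps-rows ⟩
  alt (concatMap hypRow (allFin (suc (suc M)))) (λ S → ⟦ spans? dec S ⟧)
    ≡⟨ rows-sum (suc M) 0 id (λ _ → refl) refl _ isOne
         (λ S b P → ⟦⟧-cong (spans⇒oneBlock P) (λ { refl → oneBlock⇒spans P }) (spans? dec S) (b ℕ.≟ 1))
         (λ S iso → ⟦⟧-no (isolated⇒¬spans iso) (spans? dec S)) ⟩
  rows M (row isOne) 0
    -- The row of smallest index is added last, hence acts first on the final indicator; it produces
    -- the power with x = 1.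
    ≡⟨ rows-cong M row-isOne 0 ⟩
  rows M (colourings 1) 0
    ≡⟨ rows-colourings M 1 ⟩
  - gandhi M 1 ∎


theorem3p6 : (n : ℕ) → 1 ≤ n → (dec : InterSubDec (suc n)) →
    (μH n dec ≡ - (+ numDC n)) × (μH n dec ≡ - (+ genocchi n))
theorem3p6 (suc M) _ dec =
  trans (μH-gandhi M dec) (cong -_ (sym (numDC-gandhi M))) ,
  trans (μH-gandhi M dec) (cong -_ (sym (genocchi-gandhi M)))
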